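{- For $n\ge 1$ let $\mathcal K_n=(\mathcal K_{n,1},\dots,\mathcal K_{n,n})$ be the vector obtained by setting all initial variables equal to $1$ in the Laurent expansions of the $n$ cluster variables on the new diagonal $V_2V_4$ after the flip of the $n$-triangulated square (listed from $V_2$ to $V_4$). Write $\mathcal K_{n,t}=2^{a_{n,t}}$. Then $a_{i,j}=j(i-j+1)$ for all $i\ge j\ge1$. Consequently $$\mathcal K_n=(2^{n},2^{2n-2},\dots,2^{t(n-t+1)},\dots,2^n).$$
   Context: **Mutation.** Mutation of a seed at a mutable vertex $k$ replaces $x_k$ by $x_k'=\frac1{x_k}\left(\prod_{k\to i}x_i+\prod_{j\to k}x_j\right)$ and changes the quiver by the usual quiver mutation. Arrows between frozen vertices are ignored. **$n$-triangulated square.** The quiver has vertices the integer points $(i,j)$, $0\le i,j\le n+1$, except the four corners $V_1=(n+1,n+1)$, $V_2=(n+1,0)$, $V_3=(0,0)$, $V_4=(0,n+1)$. The vertex $(i,j)$ is mutable iff $1\le i,j\le n$. The initial diagonal is $V_1V_3$. The arrows are the 3-cycles $(i,j)\to(i+1,j)\to(i+1,j+1)\to(i,j)$ for $0\le i<j\le n$, and $(i,j+1)\to(i,j)\to(i+1,j+1)\to(i,j+1)$ for $0\le j<i\le n$. **Flip from $V_1V_3$ to $V_2V_4$.** For $k=1,\dots,n$ successively, mutate (in any order) at all $(i,j)$ with $i-j\equiv k-1\pmod 2$, $|i-j|\le k-1$, $|i+j-(n+1)|\le n-k$. The $t$-th variable on $V_2V_4$ is the final variable at the point $(n+1-t,t)$,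 $1\le t\le n$. Since coefficients are positive integers, $\mathcal K_{n,t}$ is the number of monomials counted with multiplicity. (The numbers $\mathcal K_{n,t}$ are powers of $2$, so $a_{n,t}$ is a well-defined integer.) -}

module Defs where

open import Data.Nat as ℕ using (ℕ; zero; suc; _∸_; _≤_; _<_; _≤?_; _<?_; ∣_-_∣)
open import Data.Nat.DivMod using (_%_)
open import Data.Integer as ℤ using (ℤ; +_; 0ℤ; 1ℤ)
open import Data.Rational as ℚ using (ℚ)
open import Data.Fin using (Fin; toℕ)
open import Data.List as List using (List; []; _∷_; filter; foldr; foldl; upTo; cartesianProduct; cartesianProductWith)
open import Data.List.NonEmpty as List⁺ using (List⁺; _⁺++⁺_)
open import Data.List.Relation.Unary.All as All using (All)
open import Data.List.Relation.Binary.Permutation.Propositional using (_↭_)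
open import Data.Product using (Σ; _×_; _,_)
open import Data.Product.Properties using (≡-dec)
open import Data.Sum using (_⊎_; inj₁; inj₂)
open import Data.Vec using (Vec; lookup)
open import Data.Bool using (if_then_else_)
open import Relation.Nullary using (Dec; does; ¬?; _×-dec_; _⊎-dec_)
open import Relation.Nullary.Decidable using (map′)
open import Relation.Binary using (DecidableEquality)
open import Relation.Binary.PropositionalEquality using (_≡_; refl)

Point : Set
Point = ℕ × ℕ

infix 4 _≟ᴾ_

_≟ᴾ_ : DecidableEquality Point
_≟ᴾ_ = ≡-dec ℕ._≟_ ℕ._≟_

open import Data.List.Membership.DecPropositional _≟ᴾ_ using (_∈?_)

V₁ V₂ V₃ V₄ : ℕ → Point
V₁ n = suc n , suc n
V₂ n = suc n , 0
V₃ n = 0 , 0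
V₄ n = 0 , suc n

corners : ℕ → List Point
corners n = V₁ n ∷ V₂ n ∷ V₃ n ∷ V₄ n ∷ []

vertices : ℕ → List Point
vertices n = filter (λ p → ¬? (p ∈? corners n)) (cartesianProduct (upTo (2 ℕ.+ n)) (upTo (2 ℕ.+ n)))

oneTo : ℕ → List ℕ
oneTo n = List.map suc (upTo n)

mutables : ℕ → List Point
mutables n = cartesianProduct (oneTo n) (oneTo n)

-- Q u v is the number of arrows u → v.
Quiver : Set
Quiver = Point → Point → ℕ

-- Every path u → k → v adds an arrow u → v and 2-cycles are cancelled
-- (hence the ∸); arrows at k are reversed.  Arrows between frozen vertices
-- may be recorded, but as one only mutates at mutable vertices they affect
-- neither an exchange relation nor an arrow with a mutable end.
mutateQuiver : Point → Quiver → Quiver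
mutateQuiver k Q u v =
  if does (u ≟ᴾ k) then Q v u else
  if does (v ≟ᴾ k) then Q v u else
  (Q u v ℕ.+ Q u k ℕ.* Q k v) ∸ (Q v u ℕ.+ Q v k ℕ.* Q k u)

UpperCell LowerCell : ℕ → Point → Set
UpperCell n (i , j) = i < j × j ≤ n
LowerCell n (i , j) = j < i × i ≤ n

data Arrow (n : ℕ) : Point → Point → Set where
  upper₁ : ∀ {i j} → UpperCell n (i , j) → Arrow n (i , j) (suc i , j)
  upper₂ : ∀ {i j} → UpperCell n (i , j) → Arrow n (suc i , j) (suc i , suc j)
  upper₃ : ∀ {i j} → UpperCell n (i , j) → Arrow n (suc i , suc j) (i , j)
  lower₁ : ∀ {i j} → LowerCell n (i , j) → Arrow n (i , suc j) (i , j)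
  lower₂ : ∀ {i j} → LowerCell n (i , j) → Arrow n (i , j) (suc i , suc j)
  lower₃ : ∀ {i j} → LowerCell n (i , j) → Arrow n (suc i , suc j) (i , suc j)

upperCell? : ∀ n p → Dec (UpperCell n p)
upperCell? n (i , j) = (i <? j) ×-dec (j ≤? n)

lowerCell? : ∀ n p → Dec (LowerCell n p)
lowerCell? n (i , j) = (j <? i) ×-dec (i ≤? n)

arrow? : ∀ n u v → Dec (Arrow n u v)
arrow? n u@(a , b) v@(c , d) = map′ to from
  (     at (a , b)         (a , b)         (suc a , b)         upperCell?
  ⊎-dec at (ℕ.pred a , b)  (suc (ℕ.pred a) , b) (suc (ℕ.pred a) , suc b) upperCell?
  ⊎-dec at (c , d)         (suc c , suc d) (c , d)             upperCell?
  ⊎-dec at (c , d)         (c , suc d)     (c , d)             lowerCell?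
  ⊎-dec at (a , b)         (a , b)         (suc a , suc b)     lowerCell?
  ⊎-dec at (c , ℕ.pred b)  (suc c , suc (ℕ.pred b)) (c , suc (ℕ.pred b)) lowerCell?)
  where
  At : (ℕ → Point → Set) → Point → Point → Point → Set
  At C p u′ v′ = u ≡ u′ × v ≡ v′ × C n p

  at : ∀ p u′ v′ {C : ℕ → Point → Set} → (∀ m q → Dec (C m q)) → Dec (At C p u′ v′)
  at p u′ v′ C? = (u ≟ᴾ u′) ×-dec (v ≟ᴾ v′) ×-dec C? n p

  to : At UpperCell (a , b) (a , b) (suc a , b)
     ⊎ At UpperCell (ℕ.pred a , b) (suc (ℕ.pred a) , b) (suc (ℕ.pred a) , suc b)
     ⊎ At UpperCell (c , d) (suc c , suc d) (c , d)
     ⊎ At LowerCell (c , d) (c , suc d) (c , d)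
     ⊎ At LowerCell (a , b) (a , b) (suc a , suc b)
     ⊎ At LowerCell (c , ℕ.pred b) (suc c , suc (ℕ.pred b)) (c , suc (ℕ.pred b))
     → Arrow n u v
  to (inj₁ (_ , refl , h)) = upper₁ h
  to (inj₂ (inj₁ (e , e′ , h))) rewrite e | e′ = upper₂ h
  to (inj₂ (inj₂ (inj₁ (refl , _ , h)))) = upper₃ h
  to (inj₂ (inj₂ (inj₂ (inj₁ (refl , _ , h))))) = lower₁ h
  to (inj₂ (inj₂ (inj₂ (inj₂ (inj₁ (_ , refl , h)))))) = lower₂ h
  to (inj₂ (inj₂ (inj₂ (inj₂ (inj₂ (e , e′ , h)))))) rewrite e | e′ = lower₃ h

  from : Arrow n u v
     → At UpperCell (a , b) (a , b) (suc a , b)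
     ⊎ At UpperCell (ℕ.pred a , b) (suc (ℕ.pred a) , b) (suc (ℕ.pred a) , suc b)
     ⊎ At UpperCell (c , d) (suc c , suc d) (c , d)
     ⊎ At LowerCell (c , d) (c , suc d) (c , d)
     ⊎ At LowerCell (a , b) (a , b) (suc a , suc b)
     ⊎ At LowerCell (c , ℕ.pred b) (suc c , suc (ℕ.pred b)) (c , suc (ℕ.pred b))
  from (upper₁ h) = inj₁ (refl , refl , h)
  from (upper₂ h) = inj₂ (inj₁ (refl , refl , h))
  from (upper₃ h) = inj₂ (inj₂ (inj₁ (refl , refl , h)))
  from (lower₁ h) = inj₂ (inj₂ (inj₂ (inj₁ (refl , refl , h))))
  from (lower₂ h) = inj₂ (inj₂ (inj₂ (inj₂ (inj₁ (refl , refl , h)))))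
  from (lower₃ h) = inj₂ (inj₂ (inj₂ (inj₂ (inj₂ (refl , refl , h)))))

-- Distinct 3-cycles share no arrow, so there are no multiple arrows.
initialQuiver : ℕ → Quiver
initialQuiver n u v = if does (arrow? n u v) then 1 else 0

-- Exponent vectors in the variables x_v, v ∈ vertices n; exponents at points outside vertices n are irrelevant,
-- see _≈⟨_⟩_ below.
Monomial : Set
Monomial = Point → ℤ

infix 4 _≈⟨_⟩_ _≈⟨_⟩?_

_≈⟨_⟩_ : Monomial → ℕ → Monomial → Set
m ≈⟨ n ⟩ m′ = All (λ v → m v ≡ m′ v) (vertices n)

_≈⟨_⟩?_ : ∀ m n m′ → Dec (m ≈⟨ n ⟩ m′)
m ≈⟨ n ⟩? m′ = All.all? (λ v → m v ℤ.≟ m′ v) (vertices n)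

infixl 7 _∙_ _*ᴸ_ _*ᴾ_ _*_
infixl 6 _+_
infixr 8 _^_

1ᴹ : Monomial
1ᴹ _ = 0ℤ

xᴹ : Point → Monomial
xᴹ p v = if does (v ≟ᴾ p) then 1ℤ else 0ℤ

_∙_ : Monomial → Monomial → Monomial
(m ∙ m′) v = m v ℤ.+ m′ v

-- Formal sums of terms c · m, identified when all coefficients agree (_≋⟨_⟩_).
Laurent : Set
Laurent = List (ℤ × Monomial)

coeff : ℕ → Laurent → Monomial → ℤ
coeff n []            m = 0ℤ
coeff n ((c , m′) ∷ L) m = (if does (m′ ≈⟨ n ⟩? m) then c else 0ℤ) ℤ.+ coeff n L m

infix 4 _≋⟨_⟩_

_≋⟨_⟩_ : Laurent → ℕ → Laurent → Set
L ≋⟨ n ⟩ L′ = ∀ m → coeff n L m ≡ coeff n L′ m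

_*ᴸ_ : Laurent → Laurent → Laurent
_*ᴸ_ = cartesianProductWith (λ (c , m) (c′ , m′) → c ℤ.* c′ , m ∙ m′)

-- Every monomial takes the value 1 when all variables are set to 1.
atOnes : Laurent → ℤ
atOnes []            = 0ℤ
atOnes ((c , _) ∷ L) = c ℤ.+ atOnes L

-- Nonzero Laurent polynomials with coefficients in ℕ, as nonempty multisets
-- of monomials.
Positive : Set
Positive = List⁺ Monomial

_*ᴾ_ : Positive → Positive → Positive
P *ᴾ R = List⁺.concatMap (λ m → List⁺.map (m ∙_) R) P

toLaurent : Positive → Laurent
toLaurent P = List.map (λ m → 1ℤ , m) (List⁺.toList P)

-- Mutation is subtraction-free, so cluster variables are quotients of elements
-- of Positive; these form a semifield inside the field of rational functions.
record RationalFunction : Set where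
  constructor _÷_
  field
    num den : Positive

open RationalFunction public

1ᴿ : RationalFunction
1ᴿ = List⁺.[ 1ᴹ ] ÷ List⁺.[ 1ᴹ ]

xᴿ : Point → RationalFunction
xᴿ p = List⁺.[ xᴹ p ] ÷ List⁺.[ 1ᴹ ]

_+_ : RationalFunction → RationalFunction → RationalFunction
(p ÷ q) + (p′ ÷ q′) = ((p *ᴾ q′) ⁺++⁺ (p′ *ᴾ q)) ÷ (q *ᴾ q′)

_*_ : RationalFunction → RationalFunction → RationalFunction
(p ÷ q) * (p′ ÷ q′) = (p *ᴾ p′) ÷ (q *ᴾ q′)

_⁻¹ : RationalFunction → RationalFunction
(p ÷ q) ⁻¹ = q ÷ p

_^_ : RationalFunction → ℕ → RationalFunction
f ^ zero  = 1ᴿ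
f ^ suc e = f * (f ^ e)

∏ : List Point → (Point → RationalFunction) → RationalFunction
∏ ps f = foldr (λ p g → f p * g) 1ᴿ ps

-- L = num f / den f, cleared of denominators (Laurent polynomials form a domain).
IsLaurentExpansion : ℕ → Laurent → RationalFunction → Set
IsLaurentExpansion n L f = L *ᴸ toLaurent (den f) ≋⟨ n ⟩ toLaurent (num f)

valueAtOnes : RationalFunction → ℚ
valueAtOnes (p ÷ q) = (+ List⁺.length p) ℚ./ List⁺.length q

record Seed : Set where
  constructor seed
  field
    quiver     : Quiver
    clusterVar : Point → RationalFunction

open Seed public

initialSeed : ℕ → Seed
initialSeed n = seed (initialQuiver n) xᴿ

exchange : ℕ → Point → Seed → RationalFunction
exchange n k (seed Q x) =
  (∏ (vertices n) (λ i → x i ^ Q k i) + ∏ (vertices n) (λ j → x j ^ Q j k)) * x k ⁻¹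

mutate : ℕ → Point → Seed → Seed
mutate n k s = seed
  (mutateQuiver k (quiver s))
  (λ v → if does (v ≟ᴾ k) then exchange n k s else clusterVar s v)

-- For 1 ≤ k ≤ n (where the truncated subtractions are exact).
InRound : ℕ → ℕ → Point → Set
InRound n k (i , j) =
  ∣ i - j ∣ % 2 ≡ (k ∸ 1) % 2 × ∣ i - j ∣ ≤ k ∸ 1 × ∣ i ℕ.+ j - suc n ∣ ≤ n ∸ k

inRound? : ∀ n k p → Dec (InRound n k p)
inRound? n k (i , j) =
  (∣ i - j ∣ % 2 ℕ.≟ (k ∸ 1) % 2) ×-dec (∣ i - j ∣ ≤? k ∸ 1) ×-dec (∣ i ℕ.+ j - suc n ∣ ≤? n ∸ k)

record FlipOrder (n : ℕ) : Set where
  field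
    round   : ℕ → List Point
    round-↭ : ∀ k → 1 ≤ k → k ≤ n → round k ↭ filter (inRound? n k) (mutables n)

open FlipOrder public

flip : (n : ℕ) → FlipOrder n → Seed
flip n σ = foldl (λ s k → foldl (λ s′ p → mutate n p s′) s (round σ k)) (initialSeed n) (oneTo n)

newDiagonal : (n : ℕ) → FlipOrder n → ℕ → RationalFunction
newDiagonal n σ t = clusterVar (flip n σ) (suc n ∸ t , t)

-- A relation, since expansions exist only by the Laurent phenomenon; they are
-- unique up to _≋⟨_⟩_.  The entry K_t, 1 ≤ t ≤ n, is stored at index t - 1.
Is𝒦 : (n : ℕ) → FlipOrder n → Vec ℤ n → Set
Is𝒦 n σ K = (t : Fin n) →
  Σ Laurent λ L → IsLaurentExpansion n L (newDiagonal n σ (suc (toℕ t))) × lookup K t ≡ atOnes L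

{-# OPTIONS --safe #-}

-- Let c(p) be the number of mutations performed so far at the point p = (i , j)
-- and h(p) = 2 c(p) + |i - j|.  Heights of neighbouring lattice points always
-- differ by 1, every point of a round is a local minimum of h, and mutating
-- there raises its height by 2, so h describes a stepped surface.  The quiver
-- is determined by h (horizontal edges point downhill, vertical edges uphill,
-- and each square that is not a saddle carries a diagonal), so that the
-- exchange relation is x′(p) x(p) = product of horizontal neighbours + product
-- of vertical neighbours.  At x = 1 it is solved by 2 ^ c(c + |i - j|): both
-- products have the same value.  On the new diagonal h = n + 1, hence
-- c = min(i , j) and c (c + |i - j|) = i j.
module Submission where

open import Defs using (FlipOrder; Is𝒦; newDiagonal; valueAtOnes)
open import Data.Nat using (ℕ; suc; _∸_; _≤_; _^_; _*_; _+_)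
open import Data.Integer using (ℤ; +_)
open import Data.Rational using (_/_)
open import Data.Fin using (Fin; toℕ)
open import Data.Vec using (Vec; lookup; tabulate)
open import Data.Product using (_×_)
open import Relation.Binary.PropositionalEquality using (_≡_)

open import Defs
  using ( Point; _≟ᴾ_; corners; vertices; oneTo; mutables; Quiver; mutateQuiver; Arrow; arrow?; initialQuiver
        ; upper₁; upper₂; upper₃; lower₁; lower₂; lower₃
        ; Monomial; _≈⟨_⟩_; _≈⟨_⟩?_; Laurent; Positive; coeff; _≋⟨_⟩_; _*ᴸ_; atOnes; _*ᴾ_; toLaurent
        ; _∙_; IsLaurentExpansion
        ; RationalFunction; _÷_; num; den; _⁻¹; ∏; Seed; seed; quiver; clusterVar
        ; initialSeed; exchange; mutate; InRound; inRound?; round; round-↭; flip )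
  renaming (_+_ to _+ᴿ_; _*_ to _*ᴿ_; _^_ to _^ᴿ_)
open import Data.Bool using (if_then_else_; true; false)
open import Data.Fin.Properties using (toℕ<n; toℕ-fromℕ<)
open import Data.Fin using (fromℕ<)
import Data.Integer as Int
import Data.Integer.Properties as Int
open import Data.List as List using (List; []; _∷_; _++_; _∷ʳ_; map; filter; foldl; length; upTo)
open import Data.List.Properties using (length-map; length-++; foldl-∷ʳ; map-++; upTo-∷ʳ)
open import Data.List.NonEmpty as List⁺ using (List⁺; _∷_; _⁺++⁺_)
open import Data.List.NonEmpty.Properties using (length-⁺++⁺)
open import Data.List.Membership.Propositional using (_∈_; _∉_)
open import Data.List.Membership.Propositional.Properties
  using (∈-filter⁺; ∈-filter⁻; ∈-cartesianProduct⁺; ∈-upTo⁺; ∈-map⁺)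
open import Data.List.Relation.Binary.Permutation.Propositional using (_↭_; ↭-sym; ↭⇒↭ₛ)
open import Data.List.Relation.Binary.Permutation.Propositional.Properties using (∈-resp-↭)
open import Data.List.Relation.Unary.All as All using (All; []; _∷_)
open import Data.List.Relation.Unary.AllPairs using ([]; _∷_)
open import Data.List.Relation.Unary.Any using (here; there)
open import Data.List.Relation.Unary.Unique.Propositional using (Unique)
import Data.List.Relation.Unary.Unique.Propositional.Properties as Unique
open import Data.Nat using (zero; _<_; _<?_; _≟_; ∣_-_∣; z≤n; s≤s)
open import Data.Nat.ListAction using (sum)
open import Data.Nat.DivMod using (_%_; [m+kn]%n≡m%n)
open import Data.Nat.Properties
open import Data.Nat.Solver using (module +-*-Solver)
open import Data.Product using (_,_; proj₁; proj₂; ∃)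
open import Data.Rational.Properties using (fromℚᵘ-cong)
open import Data.Rational.Unnormalised using (mkℚᵘ; *≡*)
open import Data.Sum using (_⊎_; inj₁; inj₂; swap)
open import Data.Vec.Properties using (tabulate∘lookup; tabulate-cong)
open import Function using (mk⇔; _∘_; case_of_)
open import Relation.Binary.PropositionalEquality using (refl; sym; trans; cong; cong₂; subst; subst₂; _≢_; module ≡-Reasoning)
open import Relation.Binary.Definitions using (tri<; tri≈; tri>)
open import Relation.Binary.PropositionalEquality.Properties using (setoid)
open import Data.List.Relation.Binary.Permutation.Setoid.Properties (setoid Point) using (Unique-resp-↭)
open import Relation.Nullary using (Dec; yes; no; does; ¬_; ¬?; _×-dec_; _⊎-dec_; contradiction)
open import Relation.Nullary.Decidable using (map′; dec-true; dec-false; does-⇔)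
open +-*-Solver using (solve; _:=_; _:+_; _:*_; con)
open import Data.List.Membership.DecPropositional _≟ᴾ_ using (_∈?_)

-- Sums and values

sum-zero : ∀ (w : Point → ℕ) ps → (∀ {v} → v ∈ ps → w v ≡ 0) → sum (map w ps) ≡ 0
sum-zero w []       z = refl
sum-zero w (p ∷ ps) z = cong₂ _+_ (z (here refl)) (sum-zero w ps (z ∘ there))

sum-single : ∀ (w : Point → ℕ) {a ps} → Unique ps → a ∈ ps →
  (∀ {v} → v ∈ ps → v ≢ a → w v ≡ 0) → sum (map w ps) ≡ w a
sum-single w {a} (p∉ ∷ u) (here refl) z =
  trans (cong (_+_ (w a)) (sum-zero w _ λ v∈ → z (there v∈) (λ { refl → All.lookup p∉ v∈ refl }))) (+-identityʳ _)
sum-single w (p∉ ∷ u) (there a∈) z =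
  cong₂ _+_ (z (here refl) (All.lookup p∉ a∈)) (sum-single w u a∈ (z ∘ there))

-- A local minimum has two outgoing and two incoming arrows. The sum of exponents over all vertices,
-- taken for one product of its exchange relation, therefore collapses to two terms.
sum-pair : ∀ (w : Point → ℕ) {a b ps} → Unique ps → a ∈ ps → b ∈ ps → a ≢ b →
  (∀ v → v ≢ a → v ≢ b → w v ≡ 0) → sum (map w ps) ≡ w a + w b
sum-pair w u (here refl) (here refl) a≢b z = contradiction refl a≢b
sum-pair w {a} (p∉ ∷ u) (here refl) (there b∈) a≢b z =
  cong (_+_ (w a)) (sum-single w u b∈ λ v∈ v≢b → z _ (λ { refl → All.lookup p∉ v∈ refl }) v≢b)
sum-pair w {a} {b} (p∉ ∷ u) (there a∈) (here refl) a≢b z =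
  trans (cong (_+_ (w b)) (sum-single w u a∈ λ v∈ v≢a → z _ v≢a (λ { refl → All.lookup p∉ v∈ refl }))) (+-comm (w b) _)
sum-pair w (p∉ ∷ u) (there a∈) (there b∈) a≢b z =
  cong₂ _+_ (z _ (All.lookup p∉ a∈) (All.lookup p∉ b∈)) (sum-pair w u a∈ b∈ a≢b z)

∣_∣⁺ : Positive → ℕ
∣_∣⁺ = List⁺.length

length-*ᴾ : ∀ P R → ∣ P *ᴾ R ∣⁺ ≡ ∣ P ∣⁺ * ∣ R ∣⁺
length-*ᴾ (m ∷ ms) R = go m ms
  where
  go : ∀ m ms → List⁺.length ((m ∷ ms) *ᴾ R) ≡ suc (length ms) * List⁺.length R
  go m []        = trans (length-++ (List⁺.toList (List⁺.map _ R)))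
                     (cong (_+ 0) (cong suc (length-map _ (List⁺.tail R))))
  go m (m′ ∷ ms) = trans (length-++ (List⁺.toList (List⁺.map _ R)))
                     (cong₂ _+_ (cong suc (length-map _ (List⁺.tail R))) (go m′ ms))

-- Every monomial has value 1 at `x = 1`, so the length of a `Positive` is its value there. Clearing
-- the denominator keeps the calculation in `ℕ`.
HasValue2^ : RationalFunction → ℕ → Set
HasValue2^ f e = ∣ num f ∣⁺ ≡ 2 ^ e * ∣ den f ∣⁺

value-* : ∀ {f g d e} → HasValue2^ f d → HasValue2^ g e → HasValue2^ (f *ᴿ g) (d + e)
value-* {p ÷ q} {p′ ÷ q′} {d} {e} vf vg = begin
  ∣ p *ᴾ p′ ∣⁺              ≡⟨ length-*ᴾ p p′ ⟩
  ∣ p ∣⁺ * ∣ p′ ∣⁺                    ≡⟨ cong₂ _*_ vf vg ⟩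
  2 ^ d * ∣ q ∣⁺ * (2 ^ e * ∣ q′ ∣⁺)  ≡⟨ [m*n]*[o*p]≡[m*o]*[n*p] (2 ^ d) _ _ _ ⟩
  2 ^ d * 2 ^ e * (∣ q ∣⁺ * ∣ q′ ∣⁺)  ≡⟨ cong₂ _*_ (sym (^-distribˡ-+-* 2 d e)) (sym (length-*ᴾ q q′)) ⟩
  2 ^ (d + e) * ∣ q *ᴾ q′ ∣⁺          ∎
  where open ≡-Reasoning

-- Two powers of 2 add up to a power of 2 only if they are equal. An exchange relation is therefore
-- evaluated by first showing that its two products have the same exponent.
value-+ : ∀ {f g e} → HasValue2^ f e → HasValue2^ g e → HasValue2^ (f +ᴿ g) (suc e)
value-+ {p ÷ q} {p′ ÷ q′} {e} vf vg = begin
  ∣ (p *ᴾ q′) ⁺++⁺ (p′ *ᴾ q) ∣⁺        ≡⟨ length-⁺++⁺ (p *ᴾ q′) (p′ *ᴾ q) ⟩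
  ∣ p *ᴾ q′ ∣⁺ + ∣ p′ *ᴾ q ∣⁺ ≡⟨ cong₂ _+_ (length-*ᴾ p q′) (length-*ᴾ p′ q) ⟩
  ∣ p ∣⁺ * ∣ q′ ∣⁺ + ∣ p′ ∣⁺ * ∣ q ∣⁺              ≡⟨ cong₂ (λ a b → a * ∣ q′ ∣⁺ + b * ∣ q ∣⁺) vf vg ⟩
  2 ^ e * ∣ q ∣⁺ * ∣ q′ ∣⁺ + 2 ^ e * ∣ q′ ∣⁺ * ∣ q ∣⁺
    ≡⟨ solve 3 (λ x a b → x :* a :* b :+ x :* b :* a := con 2 :* x :* (a :* b)) refl (2 ^ e) ∣ q ∣⁺ ∣ q′ ∣⁺ ⟩
  2 ^ suc e * (∣ q ∣⁺ * ∣ q′ ∣⁺)                   ≡⟨ cong (2 ^ suc e *_) (sym (length-*ᴾ q q′)) ⟩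
  2 ^ suc e * ∣ q *ᴾ q′ ∣⁺                         ∎
  where open ≡-Reasoning

value-*⁻¹ : ∀ {f g d e} → HasValue2^ f (d + e) → HasValue2^ g e → HasValue2^ (f *ᴿ g ⁻¹) d
value-*⁻¹ {p ÷ q} {p′ ÷ q′} {d} {e} vf vg = begin
  ∣ p *ᴾ q′ ∣⁺           ≡⟨ length-*ᴾ p q′ ⟩
  ∣ p ∣⁺ * ∣ q′ ∣⁺                 ≡⟨ cong (_* ∣ q′ ∣⁺) vf ⟩
  2 ^ (d + e) * ∣ q ∣⁺ * ∣ q′ ∣⁺   ≡⟨ cong (λ x → x * ∣ q ∣⁺ * ∣ q′ ∣⁺) (^-distribˡ-+-* 2 d e) ⟩
  2 ^ d * 2 ^ e * ∣ q ∣⁺ * ∣ q′ ∣⁺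
    ≡⟨ solve 4 (λ x y a b → x :* y :* a :* b := x :* (a :* (y :* b))) refl (2 ^ d) (2 ^ e) ∣ q ∣⁺ ∣ q′ ∣⁺ ⟩
  2 ^ d * (∣ q ∣⁺ * (2 ^ e * ∣ q′ ∣⁺)) ≡⟨ cong (λ x → 2 ^ d * (∣ q ∣⁺ * x)) (sym vg) ⟩
  2 ^ d * (∣ q ∣⁺ * ∣ p′ ∣⁺)       ≡⟨ cong (2 ^ d *_) (sym (length-*ᴾ q p′)) ⟩
  2 ^ d * ∣ q *ᴾ p′ ∣⁺             ∎
  where open ≡-Reasoning

value-^ : ∀ {f e} k → HasValue2^ f e → HasValue2^ (f ^ᴿ k) (k * e)
value-^ zero vf = refl
value-^ {f} {e} (suc k) vf = value-* {f} {f ^ᴿ k} {e} {k * e} vf (value-^ k vf)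

value-∏ : ∀ ps f (e : Point → ℕ) → (∀ v → HasValue2^ (f v) (e v)) → HasValue2^ (∏ ps f) (sum (map e ps))
value-∏ []       f e v = refl
value-∏ (p ∷ ps) f e v = value-* {f p} {∏ ps f} {e p} {sum (map e ps)} (v p) (value-∏ ps f e v)

valueAtOnes-power : ∀ f e → HasValue2^ f e → valueAtOnes f ≡ + (2 ^ e) / 1
valueAtOnes-power (p ÷ q) e v = fromℚᵘ-cong {mkℚᵘ (+ List⁺.length p) (length (List⁺.tail q))} {mkℚᵘ (+ (2 ^ e)) 0}
  (*≡* (trans (Int.*-identityʳ _)
  (trans (cong +_ v) (Int.pos-* (2 ^ e) (List⁺.length q)))))

-- Specialisation of Laurent polynomials

-- `atOnes` reads the list of terms, whereas `_≋⟨_⟩_` sees only total coefficients, behind which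
-- cancelling terms may hide. Discarding a whole class of equal monomials at once is the induction
-- step that reconciles the two.
without : ℕ → Monomial → Laurent → Laurent
without n m []            = []
without n m ((c , m′) ∷ L) = if does (m′ ≈⟨ n ⟩? m) then without n m L else (c , m′) ∷ without n m L

≈-sym : ∀ n {m m′} → m ≈⟨ n ⟩ m′ → m′ ≈⟨ n ⟩ m
≈-sym n = All.map sym

≈-trans : ∀ n {m m′ m″} → m ≈⟨ n ⟩ m′ → m′ ≈⟨ n ⟩ m″ → m ≈⟨ n ⟩ m″
≈-trans n p q = All.zipWith (λ (e , e′) → trans e e′) (p , q)

atOnes-split : ∀ n m L → atOnes L ≡ coeff n L m Int.+ atOnes (without n m L)
atOnes-split n m [] = refl
atOnes-split n m ((c , m′) ∷ L) with m′ ≈⟨ n ⟩? m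
... | yes _ = trans (cong (Int._+_ c) (atOnes-split n m L)) (sym (Int.+-assoc c _ _))
... | no  _ = trans (cong (Int._+_ c) (atOnes-split n m L))
  (trans (sym (Int.+-assoc c x y)) (trans (cong (Int._+ y) (trans (Int.+-comm c x) (cong (Int._+ c) (sym (Int.+-identityˡ x)))))
    (Int.+-assoc (Int.0ℤ Int.+ x) c y)))
  where x = coeff n L m
        y = atOnes (without n m L)

coeff-without-≈ : ∀ n {m m′} L → m ≈⟨ n ⟩ m′ → coeff n (without n m L) m′ ≡ Int.0ℤ
coeff-without-≈ n [] e = refl
coeff-without-≈ n {m} {m′} ((c , m″) ∷ L) e with m″ ≈⟨ n ⟩? m
... | yes _ = coeff-without-≈ n L e
... | no m″≉m rewrite dec-false (m″ ≈⟨ n ⟩? m′) (λ e′ → m″≉m (≈-trans n e′ (≈-sym n e))) =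
  trans (Int.+-identityˡ _) (coeff-without-≈ n L e)

coeff-without-≉ : ∀ n {m m′} L → ¬ m ≈⟨ n ⟩ m′ → coeff n (without n m L) m′ ≡ coeff n L m′
coeff-without-≉ n [] e = refl
coeff-without-≉ n {m} {m′} ((c , m″) ∷ L) e with m″ ≈⟨ n ⟩? m
... | yes m″≈m rewrite dec-false (m″ ≈⟨ n ⟩? m′) (λ e′ → e (≈-trans n (≈-sym n m″≈m) e′)) =
  trans (coeff-without-≉ n L e) (sym (Int.+-identityˡ _))
... | no _ = cong (Int._+_ t) (coeff-without-≉ n L e)
  where t = if does (m″ ≈⟨ n ⟩? m′) then c else Int.0ℤ

length-without : ∀ n m L → length (without n m L) ≤ length L
length-without n m [] = z≤n
length-without n m ((c , m′) ∷ L) with m′ ≈⟨ n ⟩? m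
... | yes _ = m≤n⇒m≤1+n (length-without n m L)
... | no  _ = s≤s (length-without n m L)

length-without-head : ∀ n c m L → length (without n m ((c , m) ∷ L)) ≤ length L
length-without-head n c m L with m ≈⟨ n ⟩? m
... | yes _  = length-without n m L
... | no m≉m = contradiction (All.tabulate (λ _ → refl)) m≉m

-- Induction on a bound `k` for the length. The class of the head monomial contributes its
-- coefficient, which is 0, and removing the class shortens the list while all coefficients remain
-- 0.
atOnes-zero : ∀ n L → (∀ m → coeff n L m ≡ Int.0ℤ) → atOnes L ≡ Int.0ℤ
atOnes-zero n L = go (length L) L ≤-refl
  where
  go : ∀ k L → length L ≤ k → (∀ m → coeff n L m ≡ Int.0ℤ) → atOnes L ≡ Int.0ℤ
  go k [] _ z = refl
  go (suc k) L@((c , m) ∷ L′) (s≤s l) z = trans (atOnes-split n m L)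
    (cong₂ Int._+_ (z m) (go k (without n m L) (≤-trans (length-without-head n c m L′) l) z′))
    where
    z′ : ∀ m′ → coeff n (without n m L) m′ ≡ Int.0ℤ
    z′ m′ with m ≈⟨ n ⟩? m′
    ... | yes e = coeff-without-≈ n L e
    ... | no  e = trans (coeff-without-≉ n L e) (z m′)

negate : Laurent → Laurent
negate = map λ (c , m) → Int.- c , m

coeff-negate : ∀ n L m → coeff n (negate L) m ≡ Int.- coeff n L m
coeff-negate n [] m = refl
coeff-negate n ((c , m′) ∷ L) m with m′ ≈⟨ n ⟩? m
... | yes _ = trans (cong (Int._+_ (Int.- c)) (coeff-negate n L m)) (sym (Int.neg-distrib-+ c (coeff n L m)))
... | no  _ = trans (cong (Int._+_ Int.0ℤ) (coeff-negate n L m)) (sym (Int.neg-distrib-+ Int.0ℤ (coeff n L m)))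

atOnes-negate : ∀ L → atOnes (negate L) ≡ Int.- atOnes L
atOnes-negate [] = refl
atOnes-negate ((c , _) ∷ L) = trans (cong (Int._+_ (Int.- c)) (atOnes-negate L)) (sym (Int.neg-distrib-+ c (atOnes L)))

coeff-++ : ∀ n L L′ m → coeff n (L ++ L′) m ≡ coeff n L m Int.+ coeff n L′ m
coeff-++ n [] L′ m = sym (Int.+-identityˡ _)
coeff-++ n ((c , m′) ∷ L) L′ m = trans (cong (Int._+_ t) (coeff-++ n L L′ m)) (sym (Int.+-assoc t _ _))
  where t = if does (m′ ≈⟨ n ⟩? m) then c else Int.0ℤ

atOnes-++ : ∀ L L′ → atOnes (L ++ L′) ≡ atOnes L Int.+ atOnes L′
atOnes-++ [] L′ = sym (Int.+-identityˡ _)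
atOnes-++ ((c , _) ∷ L) L′ = trans (cong (Int._+_ c) (atOnes-++ L L′)) (sym (Int.+-assoc c _ _))

atOnes-cong : ∀ n L L′ → L ≋⟨ n ⟩ L′ → atOnes L ≡ atOnes L′
atOnes-cong n L L′ e = Int.i-j≡0⇒i≡j _ _ (begin
  atOnes L Int.- atOnes L′          ≡⟨ cong (Int._+_ (atOnes L)) (atOnes-negate L′) ⟨
  atOnes L Int.+ atOnes (negate L′) ≡⟨ atOnes-++ L (negate L′) ⟨
  atOnes (L ++ negate L′)         ≡⟨ atOnes-zero n (L ++ negate L′) zeros ⟩
  Int.0ℤ                            ∎)
  where
  open ≡-Reasoning
  zeros : ∀ m → coeff n (L ++ negate L′) m ≡ Int.0ℤ
  zeros m = trans (coeff-++ n L (negate L′) m)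
    (trans (cong₂ Int._+_ (e m) (coeff-negate n L′ m)) (Int.+-inverseʳ (coeff n L′ m)))

atOnes-*ᴸ : ∀ L L′ → atOnes (L *ᴸ L′) ≡ atOnes L Int.* atOnes L′
atOnes-*ᴸ [] L′ = refl
atOnes-*ᴸ ((c , m) ∷ L) L′ = begin
  atOnes (row L′ ++ L *ᴸ L′)                      ≡⟨ atOnes-++ (row L′) (L *ᴸ L′) ⟩
  atOnes (row L′) Int.+ atOnes (L *ᴸ L′)            ≡⟨ cong₂ Int._+_ (atOnes-row L′) (atOnes-*ᴸ L L′) ⟩
  c Int.* atOnes L′ Int.+ atOnes L Int.* atOnes L′      ≡⟨ Int.*-distribʳ-+ (atOnes L′) c (atOnes L) ⟨
  (c Int.+ atOnes L) Int.* atOnes L′                  ∎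
  where
  open ≡-Reasoning
  row : Laurent → Laurent
  row = map λ (c′ , m′) → c Int.* c′ , m ∙ m′
  atOnes-row : ∀ M → atOnes (row M) ≡ c Int.* atOnes M
  atOnes-row [] = sym (Int.*-zeroʳ c)
  atOnes-row ((c′ , _) ∷ M) = trans (cong (Int._+_ (c Int.* c′)) (atOnes-row M)) (sym (Int.*-distribˡ-+ c c′ (atOnes M)))

atOnes-toLaurent : ∀ P → atOnes (toLaurent P) ≡ + List⁺.length P
atOnes-toLaurent (m ∷ ms) = go (m ∷ ms)
  where
  go : ∀ ms → atOnes (map (λ m → Int.1ℤ , m) ms) ≡ + length ms
  go []       = refl
  go (m ∷ ms) = cong (Int._+_ Int.1ℤ) (go ms)

-- Setting all variables to 1 in the equation `L` times `den f` equals `num f` leaves an equation of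
-- integers. The value of the denominator cancels because a `Positive` has at least one term.
atOnes-expansion : ∀ {n L f e} → HasValue2^ f e → IsLaurentExpansion n L f → atOnes L ≡ + (2 ^ e)
atOnes-expansion {n} {L} {p ÷ q} {e} v expansion = Int.*-cancelʳ-≡ _ _ (+ List⁺.length q) (begin
  atOnes L Int.* + List⁺.length q         ≡⟨ cong (atOnes L Int.*_) (atOnes-toLaurent q) ⟨
  atOnes L Int.* atOnes (toLaurent q)     ≡⟨ atOnes-*ᴸ L (toLaurent q) ⟨
  atOnes (L *ᴸ toLaurent q)             ≡⟨ atOnes-cong n (L *ᴸ toLaurent q) (toLaurent p) expansion ⟩
  atOnes (toLaurent p)                  ≡⟨ atOnes-toLaurent p ⟩
  + List⁺.length p                      ≡⟨ cong +_ v ⟩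
  + (2 ^ e * List⁺.length q)            ≡⟨ Int.pos-* (2 ^ e) _ ⟩
  + (2 ^ e) Int.* + List⁺.length q        ∎)
  where open ≡-Reasoning

-- Stepped surfaces and their quivers

Adjacent : ℕ → ℕ → Set
Adjacent a b = b ≡ suc a ⊎ a ≡ suc b

adjacent? : ∀ a b → Dec (Adjacent a b)
adjacent? a b = (b ≟ suc a) ⊎-dec (a ≟ suc b)

adjacent-irrefl : ∀ {a} → ¬ Adjacent a a
adjacent-irrefl (inj₁ e) = 1+n≢n (sym e)
adjacent-irrefl (inj₂ e) = 1+n≢n (sym e)

Horizontal Vertical Neighbour : Point → Point → Set
Horizontal (i , j) (k , l) = Adjacent i k × j ≡ l
Vertical   (i , j) (k , l) = i ≡ k × Adjacent j l
Neighbour u v = Horizontal u v ⊎ Vertical u v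

horizontal? : ∀ u v → Dec (Horizontal u v)
horizontal? (i , j) (k , l) = adjacent? i k ×-dec (j ≟ l)

vertical? : ∀ u v → Dec (Vertical u v)
vertical? (i , j) (k , l) = (i ≟ k) ×-dec adjacent? j l

horizontal-sym : ∀ {u v} → Horizontal u v → Horizontal v u
horizontal-sym (a , refl) = swap a , refl

vertical-sym : ∀ {u v} → Vertical u v → Vertical v u
vertical-sym (refl , a) = refl , swap a

horizontal⇒¬vertical : ∀ {u v} → Horizontal u v → ¬ Vertical u v
horizontal⇒¬vertical (_ , refl) (_ , a) = adjacent-irrefl a

neighbour-sym : ∀ {u v} → Neighbour u v → Neighbour v u
neighbour-sym (inj₁ e) = inj₁ (horizontal-sym e)
neighbour-sym (inj₂ e) = inj₂ (vertical-sym e)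

neighbour⇒≢ : ∀ {u v} → Neighbour u v → v ≢ u
neighbour⇒≢ (inj₁ (a , _)) refl = adjacent-irrefl a
neighbour⇒≢ (inj₂ (_ , a)) refl = adjacent-irrefl a

-- In a unit square whose corners have heights d, d + 1, d + 2, d + 1 in cyclic
-- order, the two corners of height d + 1 are joined by an arrow.
data SurfaceArrow (h : Point → ℕ) : Point → Point → Set where
  horizontal : ∀ {u v} → Horizontal u v → h v < h u → SurfaceArrow h u v
  vertical   : ∀ {u v} → Vertical u v → h u < h v → SurfaceArrow h u v
  diagonal   : ∀ {i j k l} → Adjacent i k → Adjacent j l →
               h (i , l) < h (i , j) → h (i , j) < h (k , j) → SurfaceArrow h (i , j) (k , l)

surfaceArrow? : ∀ h u v → Dec (SurfaceArrow h u v)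
surfaceArrow? h u@(i , j) v@(k , l) = map′ to from
  (     (horizontal? u v ×-dec (h v <? h u))
  ⊎-dec (vertical? u v ×-dec (h u <? h v))
  ⊎-dec (adjacent? i k ×-dec adjacent? j l ×-dec (h (i , l) <? h u) ×-dec (h u <? h (k , j))))
  where
  to : _ → SurfaceArrow h u v
  to (inj₁ (e , l))                      = horizontal e l
  to (inj₂ (inj₁ (e , l)))               = vertical e l
  to (inj₂ (inj₂ (a , a′ , l , l′))) = diagonal a a′ l l′
  from : SurfaceArrow h u v → _
  from (horizontal e l)     = inj₁ (e , l)
  from (vertical e l)       = inj₂ (inj₁ (e , l))
  from (diagonal a a′ l l′) = inj₂ (inj₂ (a , a′ , l , l′))

-- Opposite diagonal arrows in one square would order its other two corners by height in both ways.
-- Without 2-cycles, the truncated subtraction in `mutateQuiver` leaves an arrow alone if no path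
-- through the mutated point is involved.
surfaceArrow-asym : ∀ {h u v} → SurfaceArrow h u v → ¬ SurfaceArrow h v u
surfaceArrow-asym (horizontal _ l) (horizontal _ l′)         = <-asym l l′
surfaceArrow-asym (horizontal (a , refl) _) (vertical (_ , a′) _)   = adjacent-irrefl a′
surfaceArrow-asym (horizontal (a , refl) _) (diagonal _ a′ _ _) = adjacent-irrefl a′
surfaceArrow-asym (vertical (refl , a) _) (horizontal (a′ , _) _)   = adjacent-irrefl a′
surfaceArrow-asym (vertical _ l) (vertical _ l′)             = <-asym l l′
surfaceArrow-asym (vertical (refl , a) _) (diagonal a′ _ _ _)   = adjacent-irrefl a′
surfaceArrow-asym (diagonal _ a _ _) (horizontal (_ , refl) _)  = adjacent-irrefl a
surfaceArrow-asym (diagonal a _ _ _) (vertical (refl , _) _)    = adjacent-irrefl a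
surfaceArrow-asym (diagonal _ _ l₁ l₂) (diagonal _ _ l₃ l₄)  = <-asym (<-trans l₁ l₂) (<-trans l₃ l₄)

-- Defined on all of ℕ × ℕ: only arrows with a mutable end are compared with the
-- quiver of a seed.
surfaceQuiver : (Point → ℕ) → Quiver
surfaceQuiver h u v = if does (surfaceArrow? h u v) then 1 else 0

surfaceQuiver-1 : ∀ {h u v} → SurfaceArrow h u v → surfaceQuiver h u v ≡ 1
surfaceQuiver-1 {h} {u} {v} a = cong (if_then 1 else 0) (dec-true (surfaceArrow? h u v) a)

surfaceQuiver-0 : ∀ {h u v} → ¬ SurfaceArrow h u v → surfaceQuiver h u v ≡ 0
surfaceQuiver-0 {h} {u} {v} ¬a = cong (if_then 1 else 0) (dec-false (surfaceArrow? h u v) ¬a)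

surfaceQuiver-cong : ∀ {h h′ u v u′ v′} → (SurfaceArrow h u v → SurfaceArrow h′ u′ v′) →
  (SurfaceArrow h′ u′ v′ → SurfaceArrow h u v) → surfaceQuiver h u v ≡ surfaceQuiver h′ u′ v′
surfaceQuiver-cong {h} {h′} {u} {v} {u′} {v′} to from =
  cong (if_then 1 else 0) (does-⇔ (mk⇔ to from) (surfaceArrow? h u v) (surfaceArrow? h′ u′ v′))

surfaceQuiver≤1 : ∀ h u v → surfaceQuiver h u v ≤ 1
surfaceQuiver≤1 h u v with does (surfaceArrow? h u v)
... | true  = s≤s z≤n
... | false = z≤n

surfaceQuiver-∸ : ∀ h u v → surfaceQuiver h u v ∸ surfaceQuiver h v u ≡ surfaceQuiver h u v
surfaceQuiver-∸ h u v = case surfaceArrow? h u v of λ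
  { (yes uv) → cong (λ x → surfaceQuiver h u v ∸ x) (surfaceQuiver-0 (surfaceArrow-asym uv))
  ; (no ¬uv) → trans (cong (_∸ surfaceQuiver h v u) (surfaceQuiver-0 ¬uv))
      (trans (0∸n≡0 (surfaceQuiver h v u)) (sym (surfaceQuiver-0 ¬uv))) }

-- Raising a local minimum mutates the surface quiver

Stepped : (Point → ℕ) → Set
Stepped h = ∀ {u v} → Neighbour u v → Adjacent (h u) (h v)

LocalMin : (Point → ℕ) → Point → Set
LocalMin h p = ∀ {q} → Neighbour p q → h q ≡ suc (h p)

-- One mutation seen on heights alone: `p` moves from one below all its neighbours to one above
-- them. The consequences show that the surface quiver of `h′` is the mutation at `p` of that of
-- `h`: `reversed-out` and `reversed-in` treat the arrows at `p`, `mutated` all others.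
record Raise (h : Point → ℕ) (p : Point) (h′ : Point → ℕ) : Set where
  field
    stepped : Stepped h
    low     : LocalMin h p
    raised  : h′ p ≡ 2 + h p
    kept    : ∀ {v} → v ≢ p → h′ v ≡ h v

  above : ∀ {q} → Neighbour p q → h p < h q
  above e = ≤-reflexive (sym (low e))

  below : ∀ {q} → Neighbour p q → h′ q < h′ p
  below e = ≤-reflexive (trans (cong suc (trans (kept (neighbour⇒≢ e)) (low e))) (sym raised))

  neighbour-kept : ∀ {q} → Neighbour p q → h′ q ≡ h q
  neighbour-kept e = kept (neighbour⇒≢ e)

  raised-stepped : Stepped h′
  raised-stepped {u} {v} e with u ≟ᴾ p | v ≟ᴾ p
  ... | yes refl | _        = inj₂ (trans raised (cong suc (sym (trans (neighbour-kept e) (low e)))))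
  ... | no _     | yes refl = inj₁ (trans raised (cong suc (sym (trans (neighbour-kept e′) (low e′)))))
    where e′ = neighbour-sym e
  ... | no u≢p   | no v≢p   = subst₂ Adjacent (sym (kept u≢p)) (sym (kept v≢p)) (stepped e)

  -- The neighbours of `p` have equal heights, whereas a diagonal arrow into `p` would need a
  -- horizontal and a vertical neighbour of different heights. Hence only edges meet `p`, the
  -- horizontal ones pointing in and, by `out⇒vertical`, the vertical ones pointing out.
  in⇒horizontal : ∀ {v} → SurfaceArrow h v p → Horizontal p v
  in⇒horizontal (horizontal e _) = horizontal-sym e
  in⇒horizontal (vertical e l)   = contradiction l (<-asym (above (inj₂ (vertical-sym e))))
  in⇒horizontal (diagonal a a′ l l′) = contradiction
    (<-trans l l′) (<-irrefl (trans (low (inj₁ (swap a , refl))) (sym (low (inj₂ (refl , swap a′))))))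

  out⇒vertical : ∀ {v} → SurfaceArrow h p v → Vertical p v
  out⇒vertical (vertical e _)   = e
  out⇒vertical (horizontal e l) = contradiction l (<-asym (above (inj₁ e)))
  out⇒vertical (diagonal a a′ l l′) = contradiction l (<-asym (above (inj₂ (refl , a′))))

  horizontal⇒in : ∀ {v} → Horizontal p v → SurfaceArrow h v p
  horizontal⇒in e = horizontal (horizontal-sym e) (above (inj₁ e))

  vertical⇒out : ∀ {v} → Vertical p v → SurfaceArrow h p v
  vertical⇒out e = vertical e (above (inj₂ e))

  raised-out⇒horizontal : ∀ {v} → SurfaceArrow h′ p v → Horizontal p v
  raised-out⇒horizontal (horizontal e _) = e
  raised-out⇒horizontal (vertical e l)   = contradiction l (<-asym (below (inj₂ e)))
  raised-out⇒horizontal (diagonal a a′ l l′) = contradiction l′ (<-asym (below (inj₁ (a , refl))))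

  raised-in⇒vertical : ∀ {v} → SurfaceArrow h′ v p → Vertical p v
  raised-in⇒vertical (vertical e _)   = vertical-sym e
  raised-in⇒vertical (horizontal e l) = contradiction l (<-asym (below (inj₁ (horizontal-sym e))))
  raised-in⇒vertical (diagonal a a′ l l′) = contradiction (<-trans l l′)
    (<-irrefl (trans (trans (neighbour-kept e₁) (low e₁)) (sym (trans (neighbour-kept e₂) (low e₂)))))
    where
    e₁ = inj₁ (swap a , refl)
    e₂ = inj₂ (refl , swap a′)

  reversed-out : ∀ v → surfaceQuiver h v p ≡ surfaceQuiver h′ p v
  reversed-out v = surfaceQuiver-cong
    (λ a → let e = in⇒horizontal a in horizontal e (below (inj₁ e)))
    (λ a → horizontal⇒in (raised-out⇒horizontal a))

  reversed-in : ∀ v → surfaceQuiver h p v ≡ surfaceQuiver h′ v p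
  reversed-in v = surfaceQuiver-cong
    (λ a → let e = out⇒vertical a in vertical (vertical-sym e) (below (inj₂ e)))
    (λ a → vertical⇒out (raised-in⇒vertical a))

  neighbours-level : ∀ {i l} → Adjacent (proj₁ p) i → Adjacent (proj₂ p) l → h (i , proj₂ p) ≡ h (proj₁ p , l)
  neighbours-level a a′ = trans (low (inj₁ (a , refl))) (sym (low (inj₂ (refl , a′))))

  path-not-reversed : ∀ {u v} → Horizontal p u → Vertical p v → ¬ SurfaceArrow h u v
  path-not-reversed (_ , refl) (refl , a′) (horizontal (_ , refl) _) = adjacent-irrefl a′
  path-not-reversed (a , refl) (refl , _)  (vertical (refl , _) _)   = adjacent-irrefl a
  path-not-reversed eu@(_ , refl) (refl , _) (diagonal _ _ _ l)      = <-asym l (above (inj₁ eu))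

  path-cancelled : ∀ {u v} → Horizontal p u → Vertical p v → ¬ SurfaceArrow h′ v u
  path-cancelled (_ , refl) (refl , a′) (horizontal (_ , refl) _) = adjacent-irrefl a′
  path-cancelled (a , refl) (refl , _)  (vertical (refl , _) _)   = adjacent-irrefl a
  path-cancelled (_ , refl) ev@(refl , _) (diagonal _ _ l _)      = <-asym l (below (inj₂ ev))

  -- The corner `(i , l)` opposite to `p` decides. If it lies above `u`, the square has the diagonal
  -- from `v` to `u`; the path cancels it, and the raised square is a saddle. If it lies below `u`,
  -- the square is a saddle at first and raising `p` creates the diagonal from `u` to `v`.
  path-added : ∀ {u v} → Horizontal p u → Vertical p v → 1 ∸ surfaceQuiver h v u ≡ surfaceQuiver h′ u v
  path-added {u@(i , _)} {v@(_ , l)} eu@(a , refl) ev@(refl , a′) with stepped {u} {i , l} (inj₂ (refl , a′))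
  ... | inj₁ d≡ = trans (cong (1 ∸_) (surfaceQuiver-1 vu)) (sym (surfaceQuiver-0 ¬uv))
    where
    vu : SurfaceArrow h v u
    vu = diagonal a (swap a′) (above (inj₂ ev)) (subst (_< h (i , l)) (neighbours-level a a′) (≤-reflexive (sym d≡)))
    ¬uv : ¬ SurfaceArrow h′ u v
    ¬uv (horizontal (_ , refl) _) = adjacent-irrefl a′
    ¬uv (vertical (refl , _) _)   = adjacent-irrefl a
    ¬uv (diagonal _ _ d<u _)      = <-asym (≤-reflexive (sym d≡))
      (subst₂ _<_ (kept λ { refl → adjacent-irrefl a }) (neighbour-kept (inj₁ eu)) d<u)
  ... | inj₂ u≡ = trans (cong (1 ∸_) (surfaceQuiver-0 ¬vu)) (sym (surfaceQuiver-1 uv))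
    where
    ¬vu : ¬ SurfaceArrow h v u
    ¬vu (horizontal (_ , refl) _) = adjacent-irrefl a′
    ¬vu (vertical (refl , _) _)   = adjacent-irrefl a
    ¬vu (diagonal _ _ _ v<d)      = <-asym (≤-reflexive (sym u≡))
      (subst (_< h (i , l)) (sym (neighbours-level a a′)) v<d)
    uv : SurfaceArrow h′ u v
    uv = diagonal (swap a) a′
      (subst₂ _<_ (sym (kept λ { refl → adjacent-irrefl a })) (sym (neighbour-kept (inj₁ eu))) (≤-reflexive (sym u≡)))
      (below (inj₁ eu))

  paths : ∀ {u v} → Horizontal p u → Vertical p v → surfaceQuiver h u p * surfaceQuiver h p v ≡ 1
  paths eu ev = cong₂ _*_ (surfaceQuiver-1 (horizontal⇒in eu)) (surfaceQuiver-1 (vertical⇒out ev))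

  no-paths : ∀ {u v} → ¬ (Horizontal p u × Vertical p v) → surfaceQuiver h u p * surfaceQuiver h p v ≡ 0
  no-paths {u} {v} ¬e with horizontal? p u
  ... | no ¬eu = cong (_* surfaceQuiver h p v) (surfaceQuiver-0 (¬eu ∘ in⇒horizontal))
  ... | yes eu = trans (cong (surfaceQuiver h u p *_) (surfaceQuiver-0 (λ a → ¬e (eu , out⇒vertical a))))
                   (*-zeroʳ (surfaceQuiver h u p))

  -- The height at `p` could matter only if `p` were one of the other two corners of a square with
  -- diagonal `u`, `v`. Then one of `u`, `v` would be a horizontal and the other a vertical
  -- neighbour of `p`, which the hypotheses exclude.
  away : ∀ {u v} → u ≢ p → v ≢ p → ¬ (Horizontal p u × Vertical p v) → ¬ (Horizontal p v × Vertical p u) →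
    surfaceQuiver h u v ≡ surfaceQuiver h′ u v
  away {u@(i , j)} {v@(k , l)} u≢p v≢p ¬e ¬e′ = surfaceQuiver-cong to from
    where
    to : SurfaceArrow h u v → SurfaceArrow h′ u v
    to (horizontal e l) = horizontal e (subst₂ _<_ (sym (kept v≢p)) (sym (kept u≢p)) l)
    to (vertical e l)   = vertical e (subst₂ _<_ (sym (kept u≢p)) (sym (kept v≢p)) l)
    to (diagonal a a′ l₁ l₂) = diagonal a a′
      (subst₂ _<_ (sym (kept λ { refl → ¬e′ ((a , refl) , refl , swap a′) })) (sym (kept u≢p)) l₁)
      (subst₂ _<_ (sym (kept u≢p)) (sym (kept λ { refl → ¬e ((swap a , refl) , refl , a′) })) l₂)
    from : SurfaceArrow h′ u v → SurfaceArrow h u v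
    from (horizontal e l) = horizontal e (subst₂ _<_ (kept v≢p) (kept u≢p) l)
    from (vertical e l)   = vertical e (subst₂ _<_ (kept u≢p) (kept v≢p) l)
    from (diagonal a a′ l₁ l₂) = diagonal a a′
      (subst₂ _<_ (kept λ { refl → ¬e′ ((a , refl) , refl , swap a′) }) (kept u≢p) l₁)
      (subst₂ _<_ (kept u≢p) (kept λ { refl → ¬e ((swap a , refl) , refl , a′) }) l₂)

  mutated : ∀ {u v} → u ≢ p → v ≢ p →
    (surfaceQuiver h u v + surfaceQuiver h u p * surfaceQuiver h p v) ∸
    (surfaceQuiver h v u + surfaceQuiver h v p * surfaceQuiver h p u) ≡ surfaceQuiver h′ u v
  mutated {u} {v} u≢p v≢p with horizontal? p u ×-dec vertical? p v | horizontal? p v ×-dec vertical? p u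
  ... | yes (eu , ev) | _ = begin
    (S u v + S u p * S p v) ∸ (S v u + S v p * S p u)
      ≡⟨ cong₂ _∸_ (cong₂ _+_ (surfaceQuiver-0 (path-not-reversed eu ev)) (paths eu ev))
                   (trans (cong (λ x → S v u + x) (no-paths {v} {u} λ (e , _) → horizontal⇒¬vertical e ev))
                     (+-identityʳ (S v u))) ⟩
    1 ∸ S v u ≡⟨ path-added eu ev ⟩
    surfaceQuiver h′ u v ∎
    where
    open ≡-Reasoning
    S = surfaceQuiver h
  -- The path now runs from `v` through `p` to `u`, so it is subtracted. It outweighs a possible
  -- arrow from `u` to `v`, whose multiplicity is at most 1, and the truncated difference is 0.
  ... | no _ | yes (ev , eu) = trans
    (m≤n⇒m∸n≡0 (≤-trans (≤-reflexive lhs) (≤-trans S≤1 (≤-trans (≤-reflexive (sym (paths ev eu)))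
      (m≤n+m _ (S v u))))))
    (sym (surfaceQuiver-0 (path-cancelled ev eu)))
    where
    S = surfaceQuiver h
    lhs : S u v + S u p * S p v ≡ S u v
    lhs = trans (cong (λ x → S u v + x) (no-paths {u} {v} λ (e , _) → horizontal⇒¬vertical e eu)) (+-identityʳ (S u v))
    S≤1 : S u v ≤ 1
    S≤1 = surfaceQuiver≤1 h u v
  ... | no ¬e | no ¬e′ = begin
    (S u v + S u p * S p v) ∸ (S v u + S v p * S p u)
      ≡⟨ cong₂ (λ x y → (S u v + x) ∸ (S v u + y)) (no-paths ¬e) (no-paths ¬e′) ⟩
    (S u v + 0) ∸ (S v u + 0) ≡⟨ cong₂ _∸_ (+-identityʳ (S u v)) (+-identityʳ (S v u)) ⟩
    S u v ∸ S v u             ≡⟨ surfaceQuiver-∸ h u v ⟩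
    S u v                     ≡⟨ away u≢p v≢p ¬e ¬e′ ⟩
    surfaceQuiver h′ u v      ∎
    where
    open ≡-Reasoning
    S = surfaceQuiver h

-- The initial surface

closer : ∀ {i j} → i < j → ∣ suc i - j ∣ < ∣ i - j ∣
closer {zero}  {suc j} _         = ≤-refl
closer {suc i} {suc j} (s≤s i<j) = closer i<j

farther : ∀ {i j} → j ≤ i → ∣ i - j ∣ < ∣ suc i - j ∣
farther {i}     {zero}  _         = ≤-reflexive (cong suc (∣-∣-identityʳ i))
farther {suc i} {suc j} (s≤s j≤i) = farther j≤i

closer′ : ∀ {i j} → j < i → ∣ i - suc j ∣ < ∣ i - j ∣
closer′ {i} {j} j<i = subst₂ _<_ (∣-∣-comm (suc j) i) (∣-∣-comm j i) (closer j<i)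

farther′ : ∀ {i j} → i ≤ j → ∣ i - j ∣ < ∣ i - suc j ∣
farther′ {i} {j} i≤j = subst₂ _<_ (∣-∣-comm j i) (∣-∣-comm (suc j) i) (farther i≤j)

closer⁻¹ : ∀ {i j} → ∣ suc i - j ∣ < ∣ i - j ∣ → i < j
closer⁻¹ l = ≰⇒> λ j≤i → <-asym l (farther j≤i)

farther⁻¹ : ∀ {i j} → ∣ i - j ∣ < ∣ suc i - j ∣ → j ≤ i
farther⁻¹ l = ≮⇒≥ λ i<j → <-asym l (closer i<j)

closer′⁻¹ : ∀ {i j} → ∣ i - suc j ∣ < ∣ i - j ∣ → j < i
closer′⁻¹ l = ≰⇒> λ i≤j → <-asym l (farther′ i≤j)

farther′⁻¹ : ∀ {i j} → ∣ i - j ∣ < ∣ i - suc j ∣ → i ≤ j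
farther′⁻¹ l = ≮⇒≥ λ j<i → <-asym l (closer′ j<i)

distance-step : ∀ i j → Adjacent ∣ i - j ∣ ∣ suc i - j ∣
distance-step i       zero    = inj₁ (cong suc (sym (∣-∣-identityʳ i)))
distance-step zero    (suc j) = inj₂ refl
distance-step (suc i) (suc j) = distance-step i j

distance-adjacent : ∀ {i k} j → Adjacent i k → Adjacent ∣ i - j ∣ ∣ k - j ∣
distance-adjacent {i} j (inj₁ refl) = distance-step i j
distance-adjacent {_} {k} j (inj₂ refl) = swap (distance-step k j)

diagonalDistance : Point → ℕ
diagonalDistance (i , j) = ∣ i - j ∣

diagonalDistance-stepped : Stepped diagonalDistance
diagonalDistance-stepped {i , j} {k , _} (inj₁ (a , refl)) = distance-adjacent j a
diagonalDistance-stepped {i , j} {_ , l} (inj₂ (refl , a)) =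
  subst₂ Adjacent (∣-∣-comm j i) (∣-∣-comm l i) (distance-adjacent i a)

Mutable : ℕ → Point → Set
Mutable n (i , j) = (1 ≤ i × i ≤ n) × (1 ≤ j × j ≤ n)

arrow⇒surfaceArrow : ∀ {n u v} → Arrow n u v → SurfaceArrow diagonalDistance u v
arrow⇒surfaceArrow (upper₁ (i<j , _)) = horizontal (inj₁ refl , refl) (closer i<j)
arrow⇒surfaceArrow (upper₂ (i<j , _)) = vertical (refl , inj₁ refl) (closer i<j)
arrow⇒surfaceArrow (upper₃ (i<j , _)) = diagonal (inj₂ refl) (inj₂ refl) (closer i<j) (farther′ (<⇒≤ i<j))
arrow⇒surfaceArrow (lower₁ (j<i , _)) = vertical (refl , inj₂ refl) (closer′ j<i)
arrow⇒surfaceArrow (lower₂ (j<i , _)) = diagonal (inj₁ refl) (inj₁ refl) (closer′ j<i) (farther (<⇒≤ j<i))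
arrow⇒surfaceArrow (lower₃ (j<i , _)) = horizontal (inj₂ refl , refl) (closer′ j<i)

-- The surface covers all of `ℕ × ℕ`. The mutable end supplies the bound `n` of a cell and, for
-- `upper₂` and `lower₃`, the positive coordinate needed to step back to the point indexing the
-- cell.
surfaceArrow⇒arrow : ∀ {n u v} → Mutable n u ⊎ Mutable n v → SurfaceArrow diagonalDistance u v → Arrow n u v
surfaceArrow⇒arrow m (horizontal (inj₁ refl , refl) l) = upper₁ (closer⁻¹ l , j≤n m)
  where
  j≤n : ∀ {n i i′ j} → Mutable n (i , j) ⊎ Mutable n (i′ , j) → j ≤ n
  j≤n (inj₁ (_ , _ , b)) = b
  j≤n (inj₂ (_ , _ , b)) = b
surfaceArrow⇒arrow (inj₁ ((_ , i<n) , s≤s _ , _)) (horizontal (inj₂ refl , refl) l) = lower₃ (farther⁻¹ l , <⇒≤ i<n)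
surfaceArrow⇒arrow (inj₂ ((_ , i≤n) , s≤s _ , _)) (horizontal (inj₂ refl , refl) l) = lower₃ (farther⁻¹ l , i≤n)
surfaceArrow⇒arrow (inj₁ ((s≤s _ , _) , _ , j≤n)) (vertical (refl , inj₁ refl) l) = upper₂ (farther′⁻¹ l , j≤n)
surfaceArrow⇒arrow (inj₂ ((s≤s _ , _) , _ , j<n)) (vertical (refl , inj₁ refl) l) = upper₂ (farther′⁻¹ l , <⇒≤ j<n)
surfaceArrow⇒arrow m (vertical (refl , inj₂ refl) l) = lower₁ (closer′⁻¹ l , i≤n m)
  where
  i≤n : ∀ {n i j j′} → Mutable n (i , j) ⊎ Mutable n (i , j′) → i ≤ n
  i≤n (inj₁ ((_ , b) , _)) = b
  i≤n (inj₂ ((_ , b) , _)) = b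
surfaceArrow⇒arrow (inj₁ ((_ , i≤n) , _)) (diagonal (inj₁ refl) (inj₁ refl) l _) = lower₂ (closer′⁻¹ l , i≤n)
surfaceArrow⇒arrow (inj₂ ((_ , i<n) , _)) (diagonal (inj₁ refl) (inj₁ refl) l _) = lower₂ (closer′⁻¹ l , <⇒≤ i<n)
-- An arrow parallel to the new diagonal would need different heights at two corners that differ by
-- `(1 , 1)`, where `∣ i - j ∣` is the same.
surfaceArrow⇒arrow m (diagonal (inj₁ refl) (inj₂ refl) l l′) = contradiction l (<-asym l′)
surfaceArrow⇒arrow m (diagonal (inj₂ refl) (inj₁ refl) l l′) = contradiction l (<-asym l′)
surfaceArrow⇒arrow (inj₁ (_ , _ , j<n)) (diagonal (inj₂ refl) (inj₂ refl) l _) = upper₃ (closer⁻¹ l , <⇒≤ j<n)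
surfaceArrow⇒arrow (inj₂ (_ , _ , j≤n)) (diagonal (inj₂ refl) (inj₂ refl) l _) = upper₃ (closer⁻¹ l , j≤n)

initialQuiver-surface : ∀ n {u v} → Mutable n u ⊎ Mutable n v →
  initialQuiver n u v ≡ surfaceQuiver diagonalDistance u v
initialQuiver-surface n {u} {v} m = cong (if_then 1 else 0)
  (does-⇔ (mk⇔ arrow⇒surfaceArrow (surfaceArrow⇒arrow m)) (arrow? n u v) (surfaceArrow? diagonalDistance u v))

-- Mutation at local minima

height : (Point → ℕ) → Point → ℕ
height c p = 2 * c p + diagonalDistance p

-- The exponent e satisfies 4e = height² - diagonalDistance².
exponent : (Point → ℕ) → Point → ℕ
exponent c p = c p * (c p + diagonalDistance p)

bump : Point → (Point → ℕ) → Point → ℕ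
bump p c v = if does (v ≟ᴾ p) then suc (c v) else c v

bump-at : ∀ p c → bump p c p ≡ suc (c p)
bump-at p c = cong (if_then suc (c p) else c p) (dec-true (p ≟ᴾ p) refl)

bump-away : ∀ {p} c {v} → v ≢ p → bump p c v ≡ c v
bump-away {p} c {v} v≢p = cong (if_then suc (c v) else c v) (dec-false (v ≟ᴾ p) v≢p)

raise : ∀ c {p} → Stepped (height c) → LocalMin (height c) p → Raise (height c) p (height (bump p c))
raise c {p} st low = record
  { stepped = st
  ; low     = low
  ; raised  = cong (_+ diagonalDistance p) (trans (cong (2 *_) (bump-at p c)) (*-suc 2 (c p)))
  ; kept    = λ {v} v≢p → cong (λ x → 2 * x + diagonalDistance v) (bump-away c v≢p)
  }

4*exponent : ∀ c p → 4 * exponent c p + diagonalDistance p * diagonalDistance p ≡ height c p * height c p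
4*exponent c p = solve 2 (λ x d → con 4 :* (x :* (x :+ d)) :+ d :* d := (con 2 :* x :+ d) :* (con 2 :* x :+ d)) refl
  (c p) (diagonalDistance p)

-- This is `(x + 1)² + (x - 1)² = 2x² + 2` for `x = i - j`, written with absolute values.
distance-squares : ∀ i j → ∣ suc i - j ∣ * ∣ suc i - j ∣ + ∣ i - suc j ∣ * ∣ i - suc j ∣ ≡
  2 + (∣ i - j ∣ * ∣ i - j ∣ + ∣ i - j ∣ * ∣ i - j ∣)
distance-squares zero    zero    = refl
distance-squares zero    (suc j) = solve 1 (λ x → x :* x :+ (con 2 :+ x) :* (con 2 :+ x) :=
  con 2 :+ ((con 1 :+ x) :* (con 1 :+ x) :+ (con 1 :+ x) :* (con 1 :+ x))) refl j
distance-squares (suc i) zero    rewrite ∣-∣-identityʳ i = solve 1 (λ x → (con 2 :+ x) :* (con 2 :+ x) :+ x :* x :=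
  con 2 :+ ((con 1 :+ x) :* (con 1 :+ x) :+ (con 1 :+ x) :* (con 1 :+ x))) refl i
distance-squares (suc i) (suc j) = distance-squares i j

-- The identity `(y + 1)² + (y - 1)² = 2y² + 2` is used twice: for the heights around `suc H` and,
-- through `r`, for the distances around `d`. The two constants 2 add up to 4, and division by 4
-- turns this into the `suc`, which is the factor 2 gained by adding two equal products.
exchange-exponents : ∀ {e e′ a b} d d₁ d₂ H → 4 * e + d * d ≡ H * H → 4 * e′ + d * d ≡ (2 + H) * (2 + H) →
  4 * a + d₁ * d₁ ≡ suc H * suc H → 4 * b + d₂ * d₂ ≡ suc H * suc H →
  d₁ * d₁ + d₂ * d₂ ≡ 2 + (d * d + d * d) → e′ + e ≡ suc (a + b)
exchange-exponents {e} {e′} {a} {b} d d₁ d₂ H p p′ q₁ q₂ r =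
  *-cancelˡ-≡ _ _ 4 (+-cancelʳ-≡ (d * d + d * d) _ _ (begin
    4 * (e′ + e) + (d * d + d * d)
      ≡⟨ solve 3 (λ x y z → con 4 :* (x :+ y) :+ (z :+ z) := (con 4 :* x :+ z) :+ (con 4 :* y :+ z)) refl e′ e (d * d) ⟩
    (4 * e′ + d * d) + (4 * e + d * d)
      ≡⟨ cong₂ _+_ p′ p ⟩
    (2 + H) * (2 + H) + H * H
      ≡⟨ solve 1 (λ x → (con 2 :+ x) :* (con 2 :+ x) :+ x :* x :=
           con 2 :+ ((con 1 :+ x) :* (con 1 :+ x) :+ (con 1 :+ x) :* (con 1 :+ x))) refl H ⟩
    2 + (suc H * suc H + suc H * suc H)
      ≡⟨ cong (λ x → 2 + x) (cong₂ _+_ (sym q₁) (sym q₂)) ⟩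
    2 + ((4 * a + d₁ * d₁) + (4 * b + d₂ * d₂))
      ≡⟨ solve 4 (λ x y z w → con 2 :+ ((con 4 :* x :+ z) :+ (con 4 :* y :+ w)) :=
           con 4 :* (x :+ y) :+ con 2 :+ (z :+ w)) refl a b (d₁ * d₁) (d₂ * d₂) ⟩
    4 * (a + b) + 2 + (d₁ * d₁ + d₂ * d₂)
      ≡⟨ cong (λ x → 4 * (a + b) + 2 + x) r ⟩
    4 * (a + b) + 2 + (2 + (d * d + d * d))
      ≡⟨ solve 2 (λ x z → con 4 :* x :+ con 2 :+ (con 2 :+ z) := con 4 :* (con 1 :+ x) :+ z) refl (a + b) (d * d + d * d) ⟩
    4 * suc (a + b) + (d * d + d * d) ∎))
  where open ≡-Reasoning

-- Seeds described by a stepped surface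

nonCorner? : ∀ n p → Dec (p ∉ corners n)
nonCorner? n p = ¬? (p ∈? corners n)

vertices-unique : ∀ n → Unique (vertices n)
vertices-unique n = Unique.filter⁺ (nonCorner? n) (Unique.cartesianProduct⁺ (Unique.upTo⁺ (2 + n)) (Unique.upTo⁺ (2 + n)))

-- Both coordinates of a corner are extreme, so one inner coordinate suffices. A neighbour of a
-- mutable point has one, since it shares a coordinate with that point.
∈-vertices : ∀ {n i j} → i < 2 + n → j < 2 + n → (1 ≤ i × i ≤ n) ⊎ (1 ≤ j × j ≤ n) → (i , j) ∈ vertices n
∈-vertices {n} {i} {j} i< j< inner =
  ∈-filter⁺ (nonCorner? n) (∈-cartesianProduct⁺ (∈-upTo⁺ i<) (∈-upTo⁺ j<)) (not-corner inner)
  where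
  not-corner : (1 ≤ i × i ≤ n) ⊎ (1 ≤ j × j ≤ n) → (i , j) ∉ corners n
  not-corner (inj₁ (_ , le)) (here refl)                         = 1+n≰n le
  not-corner (inj₁ (_ , le)) (there (here refl))                 = 1+n≰n le
  not-corner (inj₁ (() , _)) (there (there (here refl)))
  not-corner (inj₁ (() , _)) (there (there (there (here refl))))
  not-corner (inj₂ (_ , le)) (here refl)                         = 1+n≰n le
  not-corner (inj₂ (() , _)) (there (here refl))
  not-corner (inj₂ (() , _)) (there (there (here refl)))
  not-corner (inj₂ (_ , le)) (there (there (there (here refl)))) = 1+n≰n le

-- The invariant kept by every mutation of the flip. An exchange at a mutable point reads only
-- arrows covered by `arrows`.
record OnSurface (n : ℕ) (s : Seed) (c : Point → ℕ) : Set where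
  field
    stepped : Stepped (height c)
    arrows  : ∀ {u v} → Mutable n u ⊎ Mutable n v → quiver s u v ≡ surfaceQuiver (height c) u v
    values  : ∀ v → HasValue2^ (clusterVar s v) (exponent c v)

initial-onSurface : ∀ n → OnSurface n (initialSeed n) (λ _ → 0)
initial-onSurface n = record
  { stepped = diagonalDistance-stepped
  ; arrows  = initialQuiver-surface n
  ; values  = λ _ → refl
  }

mutateQuiver-surface : ∀ {n Q h p h′} → Raise h p h′ → Mutable n p →
  (∀ {u v} → Mutable n u ⊎ Mutable n v → Q u v ≡ surfaceQuiver h u v) →
  ∀ {u v} → Mutable n u ⊎ Mutable n v → mutateQuiver p Q u v ≡ surfaceQuiver h′ u v
mutateQuiver-surface {n} {Q} {h} {p} {h′} r mp Q≡ {u} {v} m with u ≟ᴾ p | v ≟ᴾ p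
... | yes refl | _        = trans (Q≡ (inj₂ mp)) (Raise.reversed-out r v)
... | no _     | yes refl = trans (Q≡ (inj₁ mp)) (Raise.reversed-in r u)
... | no u≢p   | no v≢p   = trans
  (cong₂ _∸_ (cong₂ _+_ (Q≡ m) (cong₂ _*_ (Q≡ (inj₂ mp)) (Q≡ (inj₁ mp))))
             (cong₂ _+_ (Q≡ (swap m)) (cong₂ _*_ (Q≡ (inj₂ mp)) (Q≡ (inj₁ mp)))))
  (Raise.mutated r u≢p v≢p)

-- The arrows at `p` make `X` the product over the vertical and `Y` the product over the horizontal
-- neighbours. By `exchange-exponents` both pairs have the same sum of exponents, so `value-+`
-- applies. Dividing by the old variable leaves the exponent that belongs to one more mutation at
-- `p`.
exchange-value : ∀ {n s c p} → OnSurface n s c → Mutable n p → LocalMin (height c) p →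
  HasValue2^ (exchange n p s) (exponent (bump p c) p)
exchange-value {n} {seed Q x} {c} {p@(suc i , suc j)} on mp@((1≤i , i<n) , 1≤j , j<n) low =
  value-*⁻¹ {X +ᴿ Y} {x p} {exponent (bump p c) p} {exponent c p}
    (subst (HasValue2^ (X +ᴿ Y)) (sym down-up) (value-+ {X} {Y} {exponent c down + exponent c up} value-X value-Y))
    (values p)
  where
  open OnSurface on
  open Raise (raise c stepped low) using (in⇒horizontal; out⇒vertical; horizontal⇒in; vertical⇒out; raised)

  left right down up : Point
  left  = i , suc j
  right = 2 + i , suc j
  down  = suc i , j
  up    = suc i , 2 + j

  to-left : Horizontal p left
  to-left = inj₂ refl , refl
  to-right : Horizontal p right
  to-right = inj₁ refl , refl
  to-down : Vertical p down
  to-down = refl , inj₂ refl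
  to-up : Vertical p up
  to-up = refl , inj₁ refl

  square : ∀ {q} → Neighbour p q → 4 * exponent c q + diagonalDistance q * diagonalDistance q ≡
    suc (height c p) * suc (height c p)
  square {q} e = trans (4*exponent c q) (cong (λ h → h * h) (low e))

  raised-square : 4 * exponent (bump p c) p + ∣ i - j ∣ * ∣ i - j ∣ ≡ (2 + height c p) * (2 + height c p)
  raised-square = trans (4*exponent (bump p c) p) (cong (λ h → h * h) raised)

  down-up : exponent (bump p c) p + exponent c p ≡ suc (exponent c down + exponent c up)
  down-up = exchange-exponents {exponent c p} {exponent (bump p c) p} {exponent c down} {exponent c up}
    ∣ i - j ∣ ∣ suc i - j ∣ ∣ i - suc j ∣ (height c p) (4*exponent c p) raised-square
    (square (inj₂ to-down)) (square (inj₂ to-up)) (distance-squares i j)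

  -- `right` and `left` have the same distances as `down` and `up`, since only the difference of the
  -- coordinates matters.
  right-left : exponent (bump p c) p + exponent c p ≡ suc (exponent c right + exponent c left)
  right-left = exchange-exponents {exponent c p} {exponent (bump p c) p} {exponent c right} {exponent c left}
    ∣ i - j ∣ ∣ suc i - j ∣ ∣ i - suc j ∣ (height c p) (4*exponent c p) raised-square
    (square (inj₁ to-right)) (square (inj₁ to-left)) (distance-squares i j)

  X Y : RationalFunction
  X = ∏ (vertices n) (λ v → x v ^ᴿ Q p v)
  Y = ∏ (vertices n) (λ v → x v ^ᴿ Q v p)

  weighted : ∀ {m} v → m ≡ 1 → m * exponent c v ≡ exponent c v
  weighted v refl = *-identityˡ (exponent c v)

  out-1 : ∀ {v} → Vertical p v → Q p v ≡ 1
  out-1 e = trans (arrows (inj₁ mp)) (surfaceQuiver-1 (vertical⇒out e))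

  in-1 : ∀ {v} → Horizontal p v → Q v p ≡ 1
  in-1 e = trans (arrows (inj₂ mp)) (surfaceQuiver-1 (horizontal⇒in e))

  out-0 : ∀ v → v ≢ down → v ≢ up → Q p v * exponent c v ≡ 0
  out-0 v v≢down v≢up = cong (_* exponent c v) (trans (arrows (inj₁ mp)) (surfaceQuiver-0 λ a → other (out⇒vertical a)))
    where
    other : ¬ Vertical p v
    other (refl , inj₁ refl) = v≢up refl
    other (refl , inj₂ refl) = v≢down refl

  in-0 : ∀ v → v ≢ right → v ≢ left → Q v p * exponent c v ≡ 0
  in-0 v v≢right v≢left = cong (_* exponent c v) (trans (arrows (inj₂ mp)) (surfaceQuiver-0 λ a → other (in⇒horizontal a)))
    where
    other : ¬ Horizontal p v
    other (inj₁ refl , refl) = v≢right refl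
    other (inj₂ refl , refl) = v≢left refl

  value-X : HasValue2^ X (exponent c down + exponent c up)
  value-X = subst (HasValue2^ X)
    (trans (sum-pair (λ v → Q p v * exponent c v) (vertices-unique n)
              (∈-vertices (s≤s (m≤n⇒m≤1+n i<n)) (m≤n⇒m≤1+n (m≤n⇒m≤1+n j<n)) (inj₁ (1≤i , i<n)))
              (∈-vertices (s≤s (m≤n⇒m≤1+n i<n)) (s≤s (s≤s j<n)) (inj₁ (1≤i , i<n)))
              (λ ()) out-0)
      (cong₂ _+_ (weighted down (out-1 to-down)) (weighted up (out-1 to-up))))
    (value-∏ (vertices n) (λ v → x v ^ᴿ Q p v) (λ v → Q p v * exponent c v) (λ v → value-^ {x v} {exponent c v} (Q p v) (values v)))

  value-Y : HasValue2^ Y (exponent c down + exponent c up)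
  value-Y = subst (HasValue2^ Y)
    (trans (sum-pair (λ v → Q v p * exponent c v) (vertices-unique n)
              (∈-vertices (s≤s (s≤s i<n)) (s≤s (m≤n⇒m≤1+n j<n)) (inj₂ (1≤j , j<n)))
              (∈-vertices (m≤n⇒m≤1+n (m≤n⇒m≤1+n i<n)) (s≤s (m≤n⇒m≤1+n j<n)) (inj₂ (1≤j , j<n)))
              (λ ()) in-0)
      (trans (cong₂ _+_ (weighted right (in-1 to-right)) (weighted left (in-1 to-left)))
        (suc-injective (trans (sym right-left) down-up))))
    (value-∏ (vertices n) (λ v → x v ^ᴿ Q v p) (λ v → Q v p * exponent c v) (λ v → value-^ {x v} {exponent c v} (Q v p) (values v)))

mutate-onSurface : ∀ {n s c p} → OnSurface n s c → Mutable n p → LocalMin (height c) p →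
  OnSurface n (mutate n p s) (bump p c)
mutate-onSurface {n} {s} {c} {p} on mp low = record
  { stepped = Raise.raised-stepped r
  ; arrows  = mutateQuiver-surface r mp (OnSurface.arrows on)
  ; values  = mutated-value
  }
  where
  r = raise c (OnSurface.stepped on) low
  mutated-value : ∀ v → HasValue2^ (clusterVar (mutate n p s) v) (exponent (bump p c) v)
  mutated-value v with v ≟ᴾ p
  ... | yes refl = subst (λ e → HasValue2^ (exchange n p s) (e * (e + diagonalDistance p))) (bump-at p c)
    (exchange-value on mp low)
  ... | no _     = OnSurface.values on v

-- Rounds of the flip

mutateAll : ℕ → List Point → Seed → Seed
mutateAll n ps s = foldl (λ s′ p → mutate n p s′) s ps

bumpAll : List Point → (Point → ℕ) → Point → ℕ
bumpAll ps c = foldl (λ c′ p → bump p c′) c ps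

bumpAll-∉ : ∀ c ps {v} → v ∉ ps → bumpAll ps c v ≡ c v
bumpAll-∉ c []       v∉ = refl
bumpAll-∉ c (p ∷ ps) v∉ = trans (bumpAll-∉ (bump p c) ps (v∉ ∘ there)) (bump-away c (v∉ ∘ here))

bumpAll-∈ : ∀ c {ps v} → Unique ps → v ∈ ps → bumpAll ps c v ≡ suc (c v)
bumpAll-∈ c {p ∷ ps} (p∉ ∷ _) (here refl) =
  trans (bumpAll-∉ (bump p c) ps (λ p∈ → All.lookup p∉ p∈ refl)) (bump-at p c)
bumpAll-∈ c {p ∷ ps} (p∉ ∷ u) (there v∈) =
  trans (bumpAll-∈ (bump p c) u v∈) (cong suc (bump-away c (λ v≡p → All.lookup p∉ v∈ (sym v≡p))))

-- Neighbouring points cannot both be local minima, so the bump at `p` affects neither `q` nor a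
-- neighbour of `q`. Hence the mutations of one round may be performed in any order.
bump-localMin : ∀ {c p q} → LocalMin (height c) p → LocalMin (height c) q → q ≢ p → LocalMin (height (bump p c)) q
bump-localMin {c} {p} {q} low-p low-q q≢p {v} e =
  trans (kept v v≢p) (trans (low-q e) (cong suc (sym (kept q q≢p))))
  where
  kept : ∀ v → v ≢ p → height (bump p c) v ≡ height c v
  kept v v≢p = cong (λ x → 2 * x + diagonalDistance v) (bump-away c v≢p)
  v≢p : v ≢ p
  v≢p refl = <-asym (≤-reflexive (sym (low-q e))) (≤-reflexive (sym (low-p (neighbour-sym e))))

mutateAll-onSurface : ∀ {n s c} ps → Unique ps → (∀ {p} → p ∈ ps → Mutable n p) →
  (∀ {p} → p ∈ ps → LocalMin (height c) p) → OnSurface n s c → OnSurface n (mutateAll n ps s) (bumpAll ps c)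
mutateAll-onSurface []       _        mut low on = on
mutateAll-onSurface {n} {s} {c} (p ∷ ps) (p∉ ∷ u) mut low on = mutateAll-onSurface ps u (mut ∘ there)
  (λ {q} q∈ → bump-localMin {c} {p} {q} (low (here refl)) (low (there q∈)) (λ q≡p → All.lookup p∉ q∈ (sym q≡p)))
  (mutate-onSurface on (mut (here refl)) (low (here refl)))

antidiagonalDistance : ℕ → Point → ℕ
antidiagonalDistance n (i , j) = ∣ i + j - suc n ∣

antidiagonalDistance-step : ∀ n {u v} → Neighbour u v → antidiagonalDistance n v ≤ suc (antidiagonalDistance n u)
antidiagonalDistance-step n {i , j} {k , l} e =
  adjacent⇒≤ (distance-adjacent {i + j} {k + l} (suc n) (sums e))
  where
  sums : Neighbour (i , j) (k , l) → Adjacent (i + j) (k + l)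
  sums (inj₁ (inj₁ refl , refl)) = inj₁ refl
  sums (inj₁ (inj₂ refl , refl)) = inj₂ refl
  sums (inj₂ (refl , inj₁ refl)) = inj₁ (+-suc i j)
  sums (inj₂ (refl , inj₂ refl)) = inj₂ (+-suc i l)
  adjacent⇒≤ : ∀ {a b} → Adjacent a b → b ≤ suc a
  adjacent⇒≤ (inj₁ refl) = ≤-refl
  adjacent⇒≤ (inj₂ refl) = m≤n⇒m≤1+n (n≤1+n _)

-- For `i = 0` the two distances add up to at least `n + 1`. In general `2i` is at most `n + 1` plus
-- both distances, hence less than `2n + 1`, which excludes `n < i`.
coordinate-bounds : ∀ {n i j} → ∣ i - j ∣ + ∣ i + j - suc n ∣ < n → 1 ≤ i × i ≤ n
coordinate-bounds {n} {i} {j} near = positive , bounded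
  where
  d s : ℕ
  d = ∣ i - j ∣
  s = ∣ i + j - suc n ∣

  positive : 1 ≤ i
  positive = n≢0⇒n>0 λ { refl → <-asym near (m≤n+∣n-m∣ (suc n) j) }

  bounded : i ≤ n
  bounded = ≮⇒≥ λ n<i → <-irrefl refl (begin-strict
    suc n + n             <⟨ +-mono-≤-< n<i n<i ⟩
    i + i                 ≤⟨ +-monoʳ-≤ i (m≤n+∣m-n∣ i j) ⟩
    i + (j + d)           ≡⟨ sym (+-assoc i j d) ⟩
    i + j + d             ≤⟨ +-monoˡ-≤ d (m≤n+∣m-n∣ (i + j) (suc n)) ⟩
    suc n + s + d         ≡⟨ +-assoc (suc n) s d ⟩
    suc n + (s + d)       ≡⟨ cong (λ x → suc n + x) (+-comm s d) ⟩
    suc n + (d + s)       ≤⟨ +-monoʳ-≤ (suc n) (<⇒≤ near) ⟩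
    suc n + n             ∎)
    where open ≤-Reasoning

-- The second coordinate is treated by reflection in the initial diagonal. The conditions of a round
-- thus imply mutability, and filtering `mutables` loses no point that satisfies them.
near⇒mutable : ∀ {n m p} → m < n → diagonalDistance p ≤ m → antidiagonalDistance n p ≤ n ∸ suc m → Mutable n p
near⇒mutable {n} {m} {i , j} m<n d≤ s≤ = coordinate-bounds near , coordinate-bounds
  (subst (_< n) (cong₂ _+_ (∣-∣-comm i j) (cong (λ x → ∣ x - suc n ∣) (+-comm i j))) near)
  where
  near : ∣ i - j ∣ + ∣ i + j - suc n ∣ < n
  near = ≤-trans (s≤s (+-mono-≤ d≤ s≤)) (≤-reflexive (m+[n∸m]≡n m<n))

mutable⇒∈ : ∀ {n p} → Mutable n p → p ∈ mutables n
mutable⇒∈ ((s≤s _ , i≤n) , (s≤s _ , j≤n)) =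
  ∈-cartesianProduct⁺ (∈-map⁺ suc (∈-upTo⁺ i≤n)) (∈-map⁺ suc (∈-upTo⁺ j≤n))

oneTo-unique : ∀ n → Unique (oneTo n)
oneTo-unique n = Unique.map⁺ suc-injective (Unique.upTo⁺ n)

parity-suc : ∀ m → suc m % 2 ≢ m % 2
parity-suc (suc (suc m)) e = parity-suc m e

-- The parity of the height does not depend on `c`, so the parity condition of a round selects one
-- of two consecutive heights.
height-parity : ∀ c p → height c p % 2 ≡ diagonalDistance p % 2
height-parity c p = trans
  (cong (_% 2) (trans (+-comm (2 * c p) d) (cong (λ x → d + x) (*-comm 2 (c p)))))
  ([m+kn]%n≡m%n d (c p) 2)
  where d = diagonalDistance p

-- By `band` the surface is flat, with heights `k` and `suc k`, on a region reaching one step beyond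
-- the points of round `suc k`, so that it contains all their neighbours. `fresh` gives the heights
-- of the outer points by which the range of `diagonalDistance` widens in the next round.
record AfterRound (n k : ℕ) (c : Point → ℕ) : Set where
  field
    band  : ∀ v → diagonalDistance v ≤ suc k → antidiagonalDistance n v ≤ n ∸ k →
            height c v ≡ k ⊎ height c v ≡ suc k
    fresh : ∀ v → k ≤ diagonalDistance v → c v ≡ 0

afterRound-0 : ∀ n → AfterRound n 0 (λ _ → 0)
afterRound-0 n = record
  { band  = λ v d≤1 _ → case m≤n⇒m<n∨m≡n d≤1 of λ
      { (inj₁ d<1) → inj₁ (n<1⇒n≡0 d<1)
      ; (inj₂ d≡1) → inj₂ d≡1 }
  ; fresh = λ _ _ → refl
  }

inRound-height : ∀ {n m c v} → AfterRound n m c → m < n → InRound n (suc m) v → height c v ≡ m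
inRound-height {n} {m} {c} {v} after m<n (parity , d≤ , s≤)
  with AfterRound.band after v (m≤n⇒m≤1+n d≤) (≤-trans s≤ (∸-monoʳ-≤ n (n≤1+n m)))
... | inj₁ h≡m    = h≡m
... | inj₂ h≡1+m = contradiction
  (trans (cong (_% 2) (sym h≡1+m)) (trans (height-parity c v) parity)) (parity-suc m)

-- A neighbour of `p` still lies in the band, so its height is `m` or `suc m`. Since `p` has height
-- `m` and heights of neighbours differ by 1, only `suc m` remains.
inRound-localMin : ∀ {n m c p} → Stepped (height c) → AfterRound n m c → m < n → InRound n (suc m) p →
  LocalMin (height c) p
inRound-localMin {n} {m} {c} {p} st after m<n r@(_ , d≤ , s≤) {q} e
  with st e
... | inj₁ up   = up
... | inj₂ down with AfterRound.band after q d-q s-q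
  where
  d-q : diagonalDistance q ≤ suc m
  d-q = case diagonalDistance-stepped {p} {q} e of λ
    { (inj₁ eq) → ≤-trans (≤-reflexive eq) (s≤s d≤)
    ; (inj₂ eq) → ≤-trans (n≤1+n _) (≤-trans (≤-reflexive (sym eq)) (m≤n⇒m≤1+n d≤)) }
  s-q : antidiagonalDistance n q ≤ n ∸ m
  s-q = ≤-trans (antidiagonalDistance-step n {p} {q} e) (≤-trans (s≤s s≤) (≤-reflexive (sym (+-∸-assoc 1 m<n))))
... | inj₁ h≡m    = contradiction (trans (sym down) (trans (inRound-height {v = p} after m<n r) (sym h≡m))) 1+n≢n
... | inj₂ h≡1+m = trans h≡1+m (cong suc (sym (inRound-height {v = p} after m<n r)))

module _ {n m c ps} (after : AfterRound n m c) (m<n : m < n)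
  (ps↭ : ps ↭ filter (inRound? n (suc m)) (mutables n)) where

  round-unique : Unique ps
  round-unique = Unique-resp-↭ (↭⇒↭ₛ (↭-sym ps↭))
    (Unique.filter⁺ (inRound? n (suc m)) (Unique.cartesianProduct⁺ (oneTo-unique n) (oneTo-unique n)))

  ∈-round⁻ : ∀ {p} → p ∈ ps → InRound n (suc m) p
  ∈-round⁻ p∈ = proj₂ (∈-filter⁻ (inRound? n (suc m)) {xs = mutables n} (∈-resp-↭ ps↭ p∈))

  ∈-round⁺ : ∀ {p} → InRound n (suc m) p → p ∈ ps
  ∈-round⁺ {p} r@(_ , d≤ , s≤) = ∈-resp-↭ (↭-sym ps↭)
    (∈-filter⁺ (inRound? n (suc m)) (mutable⇒∈ (near⇒mutable {p = p} m<n d≤ s≤)) r)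

  round-mutable : ∀ {p} → p ∈ ps → Mutable n p
  round-mutable {p} p∈ = let (_ , d≤ , s≤) = ∈-round⁻ p∈ in near⇒mutable {p = p} m<n d≤ s≤

  unmutated : ∀ {v} → v ∉ ps → height (bumpAll ps c) v ≡ height c v
  unmutated {v} v∉ = cong (λ x → 2 * x + diagonalDistance v) (bumpAll-∉ c ps v∉)

  far : ∀ {v} → suc m ≤ diagonalDistance v → v ∉ ps
  far m<d v∈ = <⇒≱ m<d (proj₁ (proj₂ (∈-round⁻ v∈)))

  afterRound-suc : AfterRound n (suc m) (bumpAll ps c)
  afterRound-suc = record { band = band′ ; fresh = fresh′ }
    where
    open AfterRound after
    fresh′ : ∀ v → suc m ≤ diagonalDistance v → bumpAll ps c v ≡ 0
    fresh′ v m<d = trans (bumpAll-∉ c ps (far m<d)) (fresh v (<⇒≤ m<d))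

    band′ : ∀ v → diagonalDistance v ≤ 2 + m → antidiagonalDistance n v ≤ n ∸ suc m →
      height (bumpAll ps c) v ≡ suc m ⊎ height (bumpAll ps c) v ≡ 2 + m
    band′ v d≤ s≤ with m≤n⇒m<n∨m≡n d≤
    -- At distance `2 + m` nothing has been mutated, so the height is the distance itself.
    ... | inj₂ d≡ = inj₂ (trans (cong (λ x → 2 * x + diagonalDistance v)
                      (fresh′ v (≤-trans (n≤1+n _) (≤-reflexive (sym d≡))))) d≡)
    ... | inj₁ (s≤s d≤1+m) with band v d≤1+m (≤-trans s≤ (∸-monoʳ-≤ n (n≤1+n m)))
    ...   | inj₂ h≡1+m = inj₁ (trans (unmutated λ v∈ →
              1+n≢n (trans (sym h≡1+m) (inRound-height {v = v} after m<n (∈-round⁻ v∈)))) h≡1+m)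
    -- Height `m` puts the point into the round: the parity is right, and `diagonalDistance v` is at
    -- most the height. One mutation then lifts it to `2 + m`.
    ...   | inj₁ h≡m = inj₂ (trans
              (cong (λ x → 2 * x + diagonalDistance v) (bumpAll-∈ c round-unique (∈-round⁺ in-round)))
              (trans (cong (_+ diagonalDistance v) (*-suc 2 (c v))) (cong (λ x → 2 + x) h≡m)))
      where
      in-round : InRound n (suc m) v
      in-round = trans (sym (height-parity c v)) (cong (_% 2) h≡m)
               , ≤-trans (m≤n+m _ (2 * c v)) (≤-reflexive h≡m) , s≤

flip-onSurface : ∀ n (σ : FlipOrder n) m → m ≤ n → ∃ λ c →
  OnSurface n (foldl (λ s k → mutateAll n (round σ k) s) (initialSeed n) (oneTo m)) c × AfterRound n m c
flip-onSurface n σ zero    _   = (λ _ → 0) , initial-onSurface n , afterRound-0 n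
flip-onSurface n σ (suc m) m<n with flip-onSurface n σ m (<⇒≤ m<n)
... | c , on , after = bumpAll ps c
  , subst (λ s → OnSurface n s (bumpAll ps c)) (sym last-round)
      (mutateAll-onSurface ps (round-unique after m<n ps↭) (round-mutable after m<n ps↭)
        (λ {p} p∈ → inRound-localMin {p = p} (OnSurface.stepped on) after m<n (∈-round⁻ after m<n ps↭ p∈)) on)
  , afterRound-suc after m<n ps↭
  where
  ps : List Point
  ps = round σ (suc m)
  ps↭ : ps ↭ filter (inRound? n (suc m)) (mutables n)
  ps↭ = round-↭ σ (suc m) (s≤s z≤n) m<n
  step : Seed → ℕ → Seed
  step s k = mutateAll n (round σ k) s
  -- `foldl` runs through the rounds from the left, so the last one is split off by writing
  -- `oneTo (suc m)` as `oneTo m` followed by `suc m`.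
  last-round : foldl step (initialSeed n) (oneTo (suc m)) ≡
    mutateAll n ps (foldl step (initialSeed n) (oneTo m))
  last-round = trans
    (cong (foldl step (initialSeed n)) (trans (cong (map suc) (sym (upTo-∷ʳ m))) (map-++ suc (upTo m) (m ∷ []))))
    (foldl-∷ʳ step (initialSeed n) (suc m) (oneTo m))

-- The new diagonal

distance-parity : ∀ i j → ∣ i - j ∣ % 2 ≡ (i + j) % 2
distance-parity zero    j       = refl
distance-parity (suc i) zero    = cong (λ x → suc x % 2) (sym (+-identityʳ i))
distance-parity (suc i) (suc j) = trans (distance-parity i j) (cong (λ x → suc x % 2) (sym (+-suc i j)))

-- The hypothesis forces `c` to be the smaller of `i` and `j`, and then `c + ∣ i - j ∣` is the
-- larger.
antidiagonal-exponent : ∀ c i j → 2 * c + ∣ i - j ∣ ≡ i + j → c * (c + ∣ i - j ∣) ≡ j * i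
antidiagonal-exponent c i j e with ≤-total i j
... | inj₁ i≤j with k , refl ← m≤n⇒∃[o]m+o≡n i≤j
  rewrite ∣m-m+n∣≡n i k = subst (λ x → x * (x + k) ≡ (i + k) * i) (sym c≡i) (*-comm i (i + k))
  where
  c≡i : c ≡ i
  c≡i = *-cancelˡ-≡ c i 2 (+-cancelʳ-≡ k (2 * c) (2 * i)
    (trans e
      (solve 2 (λ x y → x :+ (x :+ y) := con 2 :* x :+ y) refl i k)))
... | inj₂ j≤i with k , refl ← m≤n⇒∃[o]m+o≡n j≤i
  rewrite ∣-∣-comm (j + k) j | ∣m-m+n∣≡n j k = cong (λ x → x * (x + k)) c≡j
  where
  c≡j : c ≡ j
  c≡j = *-cancelˡ-≡ c j 2 (+-cancelʳ-≡ k (2 * c) (2 * j)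
    (trans e
      (solve 2 (λ x y → x :+ y :+ x := con 2 :* x :+ y) refl j k)))

newDiagonal-value : ∀ n σ t → 1 ≤ t → t ≤ n → HasValue2^ (newDiagonal n σ t) (t * (n ∸ t + 1))
newDiagonal-value n σ t 1≤t t≤n with flip-onSurface n σ n ≤-refl
... | c , on , after = subst (HasValue2^ (newDiagonal n σ t)) exponent≡ (OnSurface.values on p)
  where
  p : Point
  p = suc n ∸ t , t
  i+t≡1+n : suc n ∸ t + t ≡ suc n
  i+t≡1+n = m∸n+n≡m (m≤n⇒m≤1+n t≤n)
  height≡ : height c p ≡ suc n
  -- After `n` rounds the band has narrowed to `n ∸ n`, the new diagonal itself. It allows the
  -- heights `n` and `suc n`; as the coordinates of `p` add up to `suc n`, parity rules out `n`.
  height≡ with AfterRound.band after p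
    (≤-trans (∣m-n∣≤m⊔n (suc n ∸ t) t) (⊔-lub (m∸n≤m (suc n) t) (m≤n⇒m≤1+n t≤n)))
    (≤-trans (≤-reflexive (m≡n⇒∣m-n∣≡0 i+t≡1+n)) z≤n)
  ... | inj₂ h≡ = h≡
  ... | inj₁ h≡ = contradiction
    (trans (cong (_% 2) (sym i+t≡1+n)) (trans (sym (distance-parity (suc n ∸ t) t))
      (trans (sym (height-parity c p)) (cong (_% 2) h≡))))
    (parity-suc n)
  exponent≡ : exponent c p ≡ t * (n ∸ t + 1)
  exponent≡ = trans (antidiagonal-exponent (c p) (suc n ∸ t) t (trans height≡ (sym i+t≡1+n)))
    (cong (t *_) (trans (+-∸-assoc 1 t≤n) (+-comm 1 (n ∸ t))))

2^-injective : ∀ {a b} → 2 ^ a ≡ 2 ^ b → a ≡ b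
2^-injective {a} {b} e with <-cmp a b
... | tri< a<b _ _ = contradiction e (<⇒≢ (^-monoʳ-< 2 ≤-refl a<b))
... | tri≈ _ a≡b _ = a≡b
... | tri> _ _ b<a = contradiction (sym e) (<⇒≢ (^-monoʳ-< 2 ≤-refl b<a))

theorem1p2 : (n : ℕ) → 1 ≤ n → (σ : FlipOrder n) →
    ((K : Vec ℤ n) → Is𝒦 n σ K →
    ((a : ℕ → ℕ) → ((t : Fin n) → lookup K t ≡ + (2 ^ a (suc (toℕ t)))) →
    (t : ℕ) → 1 ≤ t → t ≤ n → a t ≡ t * (n ∸ t + 1))
    × K ≡ tabulate (λ t → + (2 ^ (suc (toℕ t) * (n ∸ suc (toℕ t) + 1)))))
    × ((t : ℕ) → 1 ≤ t → t ≤ n →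
    valueAtOnes (newDiagonal n σ t) ≡ + (2 ^ (t * (n ∸ t + 1))) / 1)
theorem1p2 n _ σ = (λ K is𝒦 → exponents K is𝒦 , trans (sym (tabulate∘lookup K)) (tabulate-cong (entry K is𝒦)))
  , λ t 1≤t t≤n → valueAtOnes-power (newDiagonal n σ t) (t * (n ∸ t + 1)) (newDiagonal-value n σ t 1≤t t≤n)
  where
  entry : (K : Vec ℤ n) → Is𝒦 n σ K → (t : Fin n) →
    lookup K t ≡ + (2 ^ (suc (toℕ t) * (n ∸ suc (toℕ t) + 1)))
  entry K is𝒦 t with is𝒦 t
  ... | L , expansion , K≡ = trans K≡
    (atOnes-expansion {n} {L} {newDiagonal n σ (suc (toℕ t))} {suc (toℕ t) * (n ∸ suc (toℕ t) + 1)}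
      (newDiagonal-value n σ (suc (toℕ t)) (s≤s z≤n) (toℕ<n t)) expansion)

  exponents : (K : Vec ℤ n) → Is𝒦 n σ K → (a : ℕ → ℕ) → ((t : Fin n) → lookup K t ≡ + (2 ^ a (suc (toℕ t)))) →
    (t : ℕ) → 1 ≤ t → t ≤ n → a t ≡ t * (n ∸ t + 1)
  -- Position `suc t`, counted from 1, is stored at index `t` of the vector.
  exponents K is𝒦 a K≡ (suc t) _ t<n = subst (λ x → a (suc x) ≡ suc x * (n ∸ suc x + 1)) (toℕ-fromℕ< t<n)
    (2^-injective (Int.+-injective (trans (sym (K≡ (fromℕ< t<n))) (entry K is𝒦 (fromℕ< t<n)))))
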